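{- For every integer $n\geq 4$, $r(K_{3}, F_{4,n})=8n+1$ and $r_{\ast}(K_{3}, F_{4,n})=4n+4$.
   Context: For graphs $G,H$, the Ramsey number $r(G,H)$ is the least integer $r$ such that every red/blue edge-coloring of the complete graph $K_r$ contains a red copy of $G$ or a blue copy of $H$. For $r=r(G,H)$, let $K_{r-1}\sqcup S_{k}$ denote the graph obtained from $K_{r-1}$ by adding a new vertex $v$ and joining $v$ by edges to exactly $k$ vertices of $K_{r-1}$; the star-critical Ramsey number $r_{\ast}(G,H)$ is the least integer $k$ such that every red/blue edge-coloring of $K_{r-1}\sqcup S_{k}$ contains a red copy of $G$ or a blue copy of $H$. The generalized fan $F_{t,n}$ is $K_1+nK_t$, the join of a single vertex with the disjoint union of $n$ copies of the complete graph $K_t$. -}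

module Defs where

open import Data.Nat using (ℕ; suc; _≤_; _∸_)
open import Data.Fin using (Fin; zero; suc)
open import Data.Fin.Subset using (Subset; _∈_; ∣_∣)
open import Data.Bool using (Bool; true; false)
open import Data.Maybe using (Maybe; just; nothing)
open import Data.Product using (Σ; _×_; _,_)
open import Data.Unit using (⊤)
open import Data.Empty using (⊥)
open import Data.Sum using (_⊎_)
open import Relation.Binary.PropositionalEquality using (_≡_; _≢_)
open import Function.Definitions using (Injective)

record Graph : Set₁ where
  field
    V : Set
    E : V → V → Set
open Graph public

K : ℕ → Graph
K t = record { V = Fin t ; E = λ i j → i ≢ j }

-- generalized fan F_{t,n} = K_1 + n K_t ; centre = nothing, (a , x) = vertex x of copy a
FanE : ∀ t n → Maybe (Fin n × Fin t) → Maybe (Fin n × Fin t) → Set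
FanE t n nothing  nothing  = ⊥
FanE t n nothing  (just _) = ⊤
FanE t n (just _) nothing  = ⊤
FanE t n (just (a , x)) (just (b , y)) = (a ≡ b) × (x ≢ y)

F : ℕ → ℕ → Graph
F t n = record { V = Maybe (Fin n × Fin t) ; E = FanE t n }

-- K_{m} ⊔ S_k : vertex zero is the new vertex v, joined to suc i exactly for i ∈ S
StarE : ∀ m → Subset m → Fin (suc m) → Fin (suc m) → Set
StarE m S zero    zero    = ⊥
StarE m S zero    (suc j) = j ∈ S
StarE m S (suc i) zero    = i ∈ S
StarE m S (suc i) (suc j) = i ≢ j

KStar : (m : ℕ) → Subset m → Graph
KStar m S = record { V = Fin (suc m) ; E = StarE m S }

-- red/blue edge-colouring of a host graph: symmetric colour function (true = red, false = blue);
-- only its values on edges of the host matter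
record Colouring (Hst : Graph) : Set where
  field
    col : V Hst → V Hst → Bool
    sym : ∀ u v → col u v ≡ col v u
open Colouring public

MonoCopy : (Hst : Graph) → Colouring Hst → Bool → Graph → Set
MonoCopy Hst c b G =
  Σ (V G → V Hst) λ f → Injective _≡_ _≡_ f ×
    (∀ u w → E G u w → E Hst (f u) (f w) × (col c (f u) (f w) ≡ b))

Arrows : Graph → Graph → Graph → Set
Arrows Hst G H = ∀ (c : Colouring Hst) → MonoCopy Hst c true G ⊎ MonoCopy Hst c false H

IsLeast : (ℕ → Set) → ℕ → Set
IsLeast P r = P r × (∀ s → P s → r ≤ s)

IsRamsey : Graph → Graph → ℕ → Set
IsRamsey G H r = IsLeast (λ s → Arrows (K s) G H) r

-- r_*(G,H) = k, where r is (the value of) r(G,H)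
IsStarCritical : Graph → Graph → ℕ → ℕ → Set
IsStarCritical G H r k =
  IsLeast (λ k′ → ∀ (S : Subset (r ∸ 1)) → ∣ S ∣ ≡ k′ → Arrows (KStar (r ∸ 1) S) G H) k

{-# OPTIONS --safe #-}
module Submission where

-- Upper bounds. Let U be the 8n old vertices and R the red graph on U, which is triangle-free. A
-- triangle-free graph on 4n + 3 vertices contains n disjoint independent quadruples: r(3,4) = 9
-- removes quadruples one by one until eleven vertices are left, and these contain two. Hence
-- without a blue fan every vertex has red degree at least 4n − 3 in U. At most two of the five
-- vertices of a closed walk of length five are red neighbours of any given vertex, so such a walk
-- would give 5(4n − 3) ≤ 16n, which is false; by a similar count any vertex has a neighbour in
-- N(u) ∪ N(v) for each red edge uv. So R is bipartite, and its sides are blue cliques with exactly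
-- 4n vertices each. The new vertex v is joined to at least four vertices on each side. If it has
-- four blue neighbours on one side, they give a blue fan. Otherwise it has four red neighbours on
-- some side X and a red neighbour y on the other one, and y is joined in blue to these four.
--
-- Lower bounds. Colour the edges across a balanced cut red and all other edges blue.

open import Defs
open import Data.Bool using (Bool; true; false; not; _∧_; _xor_)
import Data.Bool.Properties as Bool
open import Data.Empty using (⊥; ⊥-elim)
open import Data.Fin using (Fin; zero; suc; toℕ; fromℕ<; remQuot; combine)
import Data.Fin.Properties as Fin
open import Data.Fin.Subset using (Subset; ∣_∣; _∈_; inside)
import Data.Fin.Subset as Subset
open import Data.Fin.Subset.Properties using (_∈?_; ∣⊥∣≡0; ∉⊥; drop-there)
open import Data.List using (List; []; _∷_; _++_; length; map; upTo; drop; allFin; lookup; tabulate)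
open import Data.List.Membership.Propositional using () renaming (_∈_ to _∈ᴸ_)
open import Data.List.Membership.Propositional.Properties using (∈-lookup; ∈-++⁺ˡ; ∈-++⁺ʳ; ∈-∃++; ∈-allFin)
open import Data.List.Properties using (length-++; length-map; length-take; length-tabulate; take++drop≡id; ++-assoc; ++-identityʳ)
open import Data.List.Relation.Binary.Permutation.Propositional using (_↭_; ↭-refl; ↭-sym; ↭-trans; ↭-reflexive; refl; prep; swap; trans; ↭⇒↭ₛ)
open import Data.List.Relation.Binary.Permutation.Propositional.Properties using (map⁺; shift; All-resp-↭; ∈-resp-↭; ↭-length; ++-comm; ++⁺ˡ; ++⁺ʳ; ++⁺)
import Data.List.Relation.Binary.Permutation.Setoid.Properties as Permₛ
open import Data.List.Relation.Unary.All as All using (All; []; _∷_)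
import Data.List.Relation.Unary.All.Properties as All
open import Data.List.Relation.Unary.AllPairs as AllPairs using (AllPairs; []; _∷_)
import Data.List.Relation.Unary.AllPairs.Properties as AllPairs
open import Data.List.Relation.Unary.Any using (here; there)
open import Data.List.Relation.Unary.Unique.Propositional using (Unique)
open import Data.List.Relation.Unary.Unique.Propositional.Properties using (allFin⁺)
open import Data.Maybe using (Maybe; just; nothing; zipWith; _>>=_; _<∣>_; from-just)
import Data.Maybe as Maybe
open import Data.Maybe.Properties using (just-injective)
open import Data.Nat
open import Data.Nat.Properties
open import Data.Nat.Tactic.RingSolver using (solve-∀)
open import Data.Product using (∃; ∃₂; ∃-syntax; _×_; _,_; proj₁; proj₂)
open import Data.Sum as Sum using (_⊎_; inj₁; inj₂; [_,_]′)
import Data.Vec as Vec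
open import Data.Vec.Properties using (lookup⇒[]=)
open import Function using (_$_; _∘_; id)
open import Function.Definitions using (Injective)
open import Relation.Binary using (Symmetric)
open import Relation.Binary.PropositionalEquality using (_≡_; _≢_; refl; cong; cong₂; subst; setoid; resp₂; ≢-sym)
  renaming (trans to ≡-trans; sym to ≡-sym)
open import Relation.Nullary using (¬_; Dec; yes; no; does; _×-dec_; ¬?)

-- Disjoint quadruples in a list of vertices.

-- Each `pack` moves one quadruple to the front and packs only what is left, so the quadruples are
-- disjoint; `none` permits leftovers. When `P` stands for blue edges, the quadruples are the blades
-- of a fan.
data Packs {V : Set} (P : V → V → Set) : ℕ → List V → Set where
  none : ∀ {xs} → Packs P 0 xs
  pack : ∀ {n xs a b c d ys} → xs ↭ a ∷ b ∷ c ∷ d ∷ ys → AllPairs P (a ∷ b ∷ c ∷ d ∷ []) →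
         Packs P n ys → Packs P (suc n) xs

module _ {V : Set} {P : V → V → Set} where

  Packs-resp-↭ : ∀ {n xs ys} → xs ↭ ys → Packs P n ys → Packs P n xs
  Packs-resp-↭ p none         = none
  Packs-resp-↭ p (pack q c r) = pack (↭-trans p q) c r

  Packs-++ : ∀ {n xs} ys → Packs P n xs → Packs P n (xs ++ ys)
  Packs-++ ys none         = none
  Packs-++ ys (pack p c r) = pack (++⁺ʳ ys p) c (Packs-++ ys r)

  Packs-clique : ∀ n {xs} → n * 4 ≤ length xs → AllPairs P xs → Packs P n xs
  Packs-clique zero _ _ = none
  Packs-clique (suc n) {a ∷ b ∷ c ∷ d ∷ xs} (s≤s (s≤s (s≤s (s≤s h))))
    ((ab ∷ ac ∷ ad ∷ _) ∷ (bc ∷ bd ∷ _) ∷ (cd ∷ _) ∷ _ ∷ xs!) =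
    pack ↭-refl ((ab ∷ ac ∷ ad ∷ []) ∷ (bc ∷ bd ∷ []) ∷ (cd ∷ []) ∷ [] ∷ [])
      (Packs-clique n h xs!)

Packs-map : ∀ {V W : Set} {P : V → V → Set} {Q : W → W → Set} (f : V → W) →
            (∀ {x y} → P x y → Q (f x) (f y)) → ∀ {n xs} → Packs P n xs → Packs Q n (map f xs)
Packs-map f g none = none
Packs-map f g (pack p ((ab ∷ ac ∷ ad ∷ _) ∷ (bc ∷ bd ∷ _) ∷ (cd ∷ _) ∷ _) r) =
  pack (map⁺ f p) ((g ab ∷ g ac ∷ g ad ∷ []) ∷ (g bc ∷ g bd ∷ []) ∷ (g cd ∷ []) ∷ [] ∷ [])
    (Packs-map f g r)

-- Decision trees for small triangle-free graphs.

-- `split i j t u` continues with t if the vertices i and j are adjacent and with u otherwise. The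
-- trees below were found by computer; `solve` checks them during type checking.
data Tree : ℕ → Set where
  one   : (a b c d : ℕ) → Tree 1
  two   : (a b c d a′ b′ c′ d′ : ℕ) → Tree 2
  split : ∀ {n} (i j : ℕ) → Tree n → Tree n → Tree n

-- A triple `(i , j , b)` records whether the vertices labelled i and j are adjacent.
Fact : Set
Fact = ℕ × ℕ × Bool

pick : (i : ℕ) (xs : List ℕ) → Maybe (∃[ ys ] xs ↭ i ∷ ys)
pick i [] = nothing
pick i (x ∷ xs) with i ≟ x
... | yes refl = just (xs , ↭-refl)
... | no _     = Maybe.map (λ { (ys , p) → x ∷ ys , ↭-trans (prep x p) (swap x i ↭-refl) }) (pick i xs)

-- Vertex 0 has the neighbours 1, 2, 3, and the vertices 4 to 8 form a five-cycle.
nine-tree : Tree 1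
nine-tree =
  split 1 4 (
     split 2 5 (
        split 3 6 (
           split 1 7 (split 2 8 (split 3 8 (one 2 3 4 7) (one 1 3 5 8)) (one 1 2 6 8)) $
           one 1 3 5 7) $
        split 3 4 (one 1 3 5 8) (one 2 3 4 6)) $
     split 3 5 (
        split 2 8 (split 1 7 (split 3 8 (one 2 3 4 7) (one 1 3 6 8)) (one 1 2 5 7)) $
        one 1 2 5 8) $
     one 1 2 3 5) $
  split 2 6 (
     split 3 5 (split 1 6 (one 1 2 5 7) (one 1 3 4 6)) $
     split 3 7 (
        split 1 5 (split 1 8 (split 2 4 (one 2 3 5 8) (one 1 2 4 7)) (one 1 3 6 8)) $
        one 1 2 3 5) $
     one 2 3 5 7) $
  split 2 4 (
     split 3 8 (split 1 7 (one 1 2 6 8) (one 1 3 4 7)) (split 3 5 (one 2 3 6 8) (one 2 3 5 8))) $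
  split 3 4 (
     split 1 6 (split 2 7 (split 3 7 (one 2 3 6 8) (one 1 3 5 7)) (one 1 2 4 7)) (one 1 2 4 6)) $
  one 1 2 3 4

-- Vertex 0 has the neighbours 1 to 5, and its nonneighbours 6 to 10 form a five-cycle. Here 6 is
-- adjacent to 1, 2, 3; in `cycle-tree-few` it is adjacent to none of these.
cycle-tree-many : Tree 2
cycle-tree-many =
  split 3 9 (
     split 4 8 (
        split 5 9 (two 1 2 4 7 3 5 8 10) $
        split 5 7 (
           split 4 6 (split 1 8 (two 1 4 5 9 2 3 7 10) (two 1 3 5 8 2 4 7 10)) $
           two 1 2 3 7 4 5 6 9) $
        two 1 2 3 10 4 5 7 9) $
     split 5 8 (
        split 4 10 (
           split 5 6 (split 1 8 (two 1 4 5 9 2 3 7 10) (two 1 3 4 8 2 5 7 10)) $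
           two 1 2 3 7 4 5 6 9) $
        two 1 2 5 7 3 4 8 10) $
     two 1 2 7 10 3 4 5 8) $
  split 4 9 (
     split 5 8 (two 1 2 4 10 3 5 7 9) $
     split 5 10 (
        split 4 6 (split 1 8 (two 1 3 5 9 2 4 7 10) (two 1 4 5 8 2 3 7 10)) $
        two 1 2 3 7 4 5 6 8) $
     two 1 2 3 7 4 5 8 10) $
  split 5 9 (
     split 4 7 (
        split 5 6 (split 1 8 (two 1 3 4 9 2 5 7 10) (two 1 4 5 8 2 3 7 10)) $
        two 1 2 3 7 4 5 6 8) $
     two 1 2 5 10 3 4 7 9) $
  two 1 2 7 10 3 4 5 9

cycle-tree-few : Tree 2
cycle-tree-few =
  split 4 7 (
     split 3 8 (
        split 5 9 (
           split 4 10 (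
              split 1 8 (
                 split 2 8 (split 5 6 (two 1 2 5 7 3 4 6 9) (two 1 2 3 7 4 5 6 8)) $
                 two 1 3 6 9 2 4 5 8) $
              split 2 8 (two 1 4 5 8 2 3 6 9) (two 1 2 5 8 3 4 6 9)) $
           two 1 2 3 6 4 5 8 10) $
        split 5 7 (
           split 1 8 (two 1 3 7 9 2 4 5 6) $
           split 2 8 (two 1 4 5 6 2 3 7 9) (two 1 2 4 8 3 5 6 9)) $
        two 1 2 4 6 3 5 7 9) $
     split 1 9 (
        split 5 10 (split 2 9 (two 1 2 8 10 3 4 5 6) (two 1 3 4 8 2 5 6 9)) $
        split 5 8 (
           split 2 10 (
              split 2 7 (split 3 10 (two 1 4 6 8 2 3 5 9) (two 1 3 5 10 2 4 6 8)) $
              two 1 3 4 6 2 5 7 9) $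
           two 1 2 5 10 3 4 6 8) $
        two 1 5 8 10 2 3 4 6) $
     split 2 9 (
        split 5 9 (two 1 3 4 6 2 5 8 10) $
        split 5 6 (
           split 4 9 (split 1 8 (two 1 5 7 9 2 3 4 6) (two 1 3 6 8 2 4 5 10)) $
           two 1 4 5 9 2 3 6 8) $
        two 1 5 6 9 2 3 4 8) $
     split 5 9 (two 1 2 6 9 3 4 5 8) (two 1 2 5 9 3 4 6 8)) $
  split 4 9 (
     split 5 10 (
        split 2 10 (
           split 3 8 (
              split 1 7 (
                 split 2 8 (split 1 9 (two 1 4 8 10 2 3 5 6) (two 1 5 6 9 2 3 4 7)) $
                 two 1 2 4 8 3 5 6 9) $
              two 1 3 4 7 2 5 6 9) $
           split 1 8 (
              split 3 10 (split 2 7 (two 1 5 6 9 2 3 4 8) (two 1 2 4 7 3 5 6 9)) $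
              two 1 2 5 6 3 4 8 10) $
           two 1 3 4 8 2 5 6 9) $
        split 2 8 (two 1 3 5 6 2 4 7 10) (two 1 3 5 6 2 4 8 10)) $
     split 5 7 (two 1 2 3 6 4 5 8 10) (two 1 2 3 6 4 5 7 10)) $
  split 5 7 (
     split 3 9 (
        split 2 9 (
           split 4 6 (split 1 8 (two 1 4 7 9 2 3 5 6) (two 1 5 6 8 2 3 4 10)) $
           two 1 4 5 6 2 3 8 10) $
        split 1 9 (
           split 2 7 (split 4 10 (two 1 3 5 8 2 4 6 9) (two 1 3 4 10 2 5 6 8)) $
           two 1 3 5 6 2 4 7 9) $
        two 1 2 4 9 3 5 6 8) $
     split 3 7 (
        split 1 9 (
           split 2 9 (split 4 10 (two 1 2 5 8 3 4 6 9) (two 1 2 4 10 3 5 6 8)) $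
           two 1 5 6 8 2 3 4 9) $
        split 2 9 (two 1 3 4 9 2 5 6 8) (two 1 2 4 9 3 5 6 8)) $
     two 1 2 5 6 3 4 7 9) $
  split 5 9 (
     split 4 10 (
        split 3 10 (
           split 1 10 (
              split 2 7 (
                 split 1 8 (split 2 10 (two 1 4 5 7 2 3 6 9) (two 1 3 4 6 2 5 8 10)) $
                 two 1 2 5 8 3 4 6 9) $
              two 1 3 6 9 2 4 5 7) $
           split 1 8 (two 1 5 7 10 2 3 4 6) (two 1 5 8 10 2 3 4 6)) $
        split 3 8 (two 1 2 4 6 3 5 7 10) (two 1 2 4 6 3 5 8 10)) $
     two 1 2 3 6 4 5 7 10) $
  two 1 2 3 6 4 5 7 9

-- Vertex 0 has the neighbours 1 to 6 and the nonneighbours 7 to 10, with 7 adjacent to 8. Here 7 is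
-- adjacent to 1, 2, 3; in `edge4-tree-few` it is adjacent to none of 1 to 4.
edge4-tree-many : Tree 2
edge4-tree-many =
  split 7 9 (two 1 2 8 9 3 4 5 6) $
  split 8 9 (
     split 4 8 (
        split 9 10 (
           split 5 9 (
              split 3 10 (split 6 9 (two 1 2 3 4 5 6 8 10) (two 1 2 5 8 3 4 6 9)) $
              two 1 2 4 6 3 5 8 10) $
           split 6 9 (split 3 10 (two 1 2 6 8 3 4 5 9) (two 1 2 4 5 3 6 8 10)) $
           two 1 2 3 8 4 5 6 9) $
        split 7 10 (two 1 2 8 10 3 4 5 6) (two 0 7 9 10 1 2 3 4)) $
     split 7 10 (two 1 2 8 10 3 4 5 6) $
     split 9 10 (
        split 4 10 (
           split 5 9 (
              split 3 10 (split 6 9 (two 1 2 3 4 5 6 8 10) (two 1 2 5 8 3 4 6 9)) $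
              two 1 2 4 6 3 5 8 10) $
           split 6 9 (split 3 10 (two 1 2 6 8 3 4 5 9) (two 1 2 4 5 3 6 8 10)) $
           two 1 2 3 8 4 5 6 9) $
        split 3 10 (
           split 2 10 (
              split 1 10 (
                 split 5 8 (split 6 9 (two 1 2 3 5 4 6 8 10) (two 1 2 4 8 3 5 6 9)) $
                 split 6 8 (two 1 2 6 9 3 4 5 8) (two 1 2 3 9 4 5 6 8)) $
              two 1 4 8 10 2 3 5 6) $
           two 1 3 5 6 2 4 8 10) $
        two 1 2 5 6 3 4 8 10) $
     two 0 7 9 10 1 2 3 4) $
  split 7 10 (two 1 2 8 10 3 4 5 6) $
  split 9 10 (
     split 1 9 (
        split 3 9 (
           split 8 10 (
              split 6 10 (
                 split 2 9 (
                    split 4 10 (two 1 2 3 5 4 6 8 9) $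
                    split 5 8 (two 1 2 6 8 3 4 5 10) (two 1 2 4 10 3 5 6 8)) $
                 two 1 3 4 5 2 6 8 9) $
              split 5 10 (split 4 10 (two 1 2 3 6 4 5 8 9) (two 1 2 5 8 3 4 6 10)) $
              split 4 10 (two 1 2 4 8 3 5 6 10) (two 1 2 3 8 4 5 6 10)) $
           two 1 3 8 10 2 4 5 6) $
        split 2 9 (
           split 8 10 (
              split 5 8 (
                 split 6 8 (two 1 2 3 4 5 6 7 10) $
                 split 4 8 (two 1 2 3 6 4 5 7 10) (two 1 2 5 10 3 4 6 8)) $
              split 5 9 (
                 split 6 10 (two 1 2 4 5 3 6 8 9) $
                 split 4 10 (two 1 2 5 6 3 4 8 9) (two 1 2 3 8 4 5 6 10)) $
              two 1 2 4 6 3 5 8 9) $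
           two 1 2 8 10 3 4 5 6) $
        two 1 4 5 6 2 3 8 9) $
     split 2 9 (
        split 3 9 (
           split 8 10 (
              split 5 8 (
                 split 6 8 (two 1 2 3 4 5 6 7 10) $
                 split 4 10 (two 1 4 6 8 2 3 5 10) (two 1 2 6 8 3 4 5 10)) $
              split 5 9 (
                 split 6 10 (two 1 6 8 9 2 3 4 5) $
                 split 4 10 (two 1 2 4 8 3 5 6 10) (two 1 2 3 8 4 5 6 10)) $
              two 1 5 8 9 2 3 4 6) $
           two 1 4 5 6 2 3 8 10) $
        two 1 3 8 9 2 4 5 6) $
     two 1 2 8 9 3 4 5 6) $
  two 0 7 9 10 1 2 3 4

edge4-tree-few : Tree 2
edge4-tree-few =
  split 7 9 (
     split 7 10 (two 0 8 9 10 1 2 3 4) $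
     split 1 10 (
        split 8 10 (
           split 5 8 (
              split 4 10 (split 6 8 (two 1 2 3 4 5 6 7 10) (two 1 4 6 8 2 3 5 7)) $
              two 1 2 3 6 4 5 7 10) $
           split 6 8 (split 4 10 (two 1 4 5 8 2 3 6 7) (two 1 2 3 5 4 6 7 10)) $
           two 1 5 6 8 2 3 4 7) $
        split 9 10 (
           split 5 9 (
              split 4 10 (split 6 9 (two 1 2 3 4 5 6 7 10) (two 1 4 6 9 2 3 5 7)) $
              two 1 2 3 6 4 5 7 10) $
           split 6 9 (split 4 10 (two 1 4 5 9 2 3 6 7) (two 1 2 3 5 4 6 7 10)) $
           two 1 5 6 9 2 3 4 7) $
        two 0 8 9 10 1 2 3 4) $
     split 2 10 (
        split 3 10 (
           split 4 10 (
              split 8 10 (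
                 split 6 7 (split 5 8 (two 1 2 5 7 3 4 6 8) (two 1 2 3 7 4 5 6 8)) $
                 split 5 8 (two 1 5 6 7 2 3 4 8) (two 1 2 6 7 3 4 5 8)) $
              split 9 10 (
                 split 5 7 (split 6 9 (two 1 2 6 7 3 4 5 9) (two 1 2 3 7 4 5 6 9)) $
                 split 6 9 (two 1 5 6 7 2 3 4 9) (two 1 2 5 7 3 4 6 9)) $
              two 0 8 9 10 1 2 3 4) $
           two 1 4 7 10 2 3 5 6) $
        two 1 3 7 10 2 4 5 6) $
     two 1 2 7 10 3 4 5 6) $
  split 1 9 (
     split 9 10 (
        split 7 10 (
           split 5 10 (
              split 4 9 (split 6 10 (two 1 2 3 4 5 6 7 9) (two 1 4 6 10 2 3 5 7)) $
              two 1 2 3 6 4 5 7 9) $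
           split 6 10 (split 4 9 (two 1 4 5 10 2 3 6 7) (two 1 2 3 5 4 6 7 9)) $
           two 1 5 6 10 2 3 4 7) $
        split 2 10 (split 4 9 (two 1 4 7 10 2 3 5 6) (two 1 3 5 6 2 4 7 9)) $
        two 1 2 7 10 3 4 5 6) $
     split 7 10 (
        split 8 9 (
           split 5 8 (
              split 4 9 (split 6 8 (two 1 2 3 4 5 6 7 9) (two 1 4 6 8 2 3 5 7)) $
              two 1 2 3 6 4 5 7 9) $
           split 6 8 (split 4 9 (two 1 4 5 8 2 3 6 7) (two 1 2 3 5 4 6 7 9)) $
           two 1 5 6 8 2 3 4 7) $
        two 0 8 9 10 1 2 3 4) $
     two 0 7 9 10 1 2 3 4) $
  split 2 9 (
     split 3 9 (
        split 4 9 (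
           split 9 10 (
              split 7 10 (
                 split 5 7 (split 6 10 (two 1 2 6 7 3 4 5 10) (two 1 2 3 7 4 5 6 10)) $
                 split 6 10 (two 1 5 6 7 2 3 4 10) (two 1 2 5 7 3 4 6 10)) $
              two 1 2 5 6 3 4 7 10) $
           split 7 10 (
              split 8 9 (
                 split 6 7 (split 5 8 (two 1 2 5 7 3 4 6 8) (two 1 2 3 7 4 5 6 8)) $
                 split 5 8 (two 1 5 6 7 2 3 4 8) (two 1 2 6 7 3 4 5 8)) $
              two 0 8 9 10 1 2 3 4) $
           two 0 7 9 10 1 2 3 4) $
        two 1 4 7 9 2 3 5 6) $
     two 1 3 7 9 2 4 5 6) $
  two 1 2 7 9 3 4 5 6

-- Vertex 0 has the neighbours 1 to 7 and the nonneighbours 8, 9, 10, with 8 adjacent to 9.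
edge3-tree : Tree 2
edge3-tree =
  split 5 8 (
     split 1 9 (
        split 4 8 (
           split 7 9 (split 6 9 (two 1 6 7 8 2 3 4 5) (two 1 2 3 7 4 5 6 9)) $
           two 1 2 3 6 4 5 7 9) $
        split 2 8 (split 7 9 (two 1 4 7 8 2 3 5 6) (two 1 3 4 6 2 5 7 9)) (two 1 2 4 8 3 5 6 7)) $
     split 2 9 (
        split 3 9 (split 7 8 (two 1 5 7 9 2 3 4 6) (two 1 4 5 6 2 3 7 8)) (two 1 3 5 9 2 4 6 7)) $
     two 1 2 5 9 3 4 6 7) $
  split 1 8 (
     split 6 9 (
        split 7 8 (split 4 8 (two 1 4 7 9 2 3 5 6) (two 1 2 3 7 4 5 6 8)) (two 1 2 3 4 5 6 7 8)) $
     split 2 9 (split 7 8 (two 1 6 7 9 2 3 4 5) (two 1 3 4 6 2 5 7 8)) (two 1 2 6 9 3 4 5 7)) $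
  split 2 8 (
     split 3 8 (split 7 9 (two 1 5 7 8 2 3 4 6) (two 1 4 5 6 2 3 7 9)) (two 1 3 5 8 2 4 6 7)) $
  two 1 2 5 8 3 4 6 7

star : ℕ → Bool → List ℕ → List Fact
star i b = map (λ j → i , j , b)

cycle-facts : List Fact
cycle-facts = star 0 true (1 ∷ 2 ∷ 3 ∷ 4 ∷ 5 ∷ []) ++
  (6 , 7 , true) ∷ (7 , 8 , true) ∷ (8 , 9 , true) ∷ (9 , 10 , true) ∷ (10 , 6 , true) ∷ []

edge4-facts : List Fact
edge4-facts = star 0 true (1 ∷ 2 ∷ 3 ∷ 4 ∷ 5 ∷ 6 ∷ []) ++ star 0 false (7 ∷ 8 ∷ 9 ∷ 10 ∷ []) ++
  (7 , 8 , true) ∷ []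

edge3-facts : List Fact
edge3-facts = star 0 true (1 ∷ 2 ∷ 3 ∷ 4 ∷ 5 ∷ 6 ∷ 7 ∷ []) ++ star 0 false (8 ∷ 9 ∷ 10 ∷ []) ++
  (8 , 9 , true) ∷ []

nine-facts : List Fact
nine-facts = (0 , 1 , true) ∷ (0 , 2 , true) ∷ (0 , 3 , true) ∷
  (4 , 5 , true) ∷ (5 , 6 , true) ∷ (6 , 7 , true) ∷ (7 , 8 , true) ∷ (8 , 4 , true) ∷ []

-- Counting in lists and partitioning them.

bit : Bool → ℕ
bit true  = 1
bit false = 0

count : ∀ {V : Set} → (V → Bool) → List V → ℕ
count p []       = 0
count p (x ∷ xs) = bit (p x) + count p xs

module _ {V : Set} where

  count-↭ : ∀ (p : V → Bool) {xs ys} → xs ↭ ys → count p xs ≡ count p ys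
  count-↭ p refl = refl
  count-↭ p (prep x q) = cong (bit (p x) +_) (count-↭ p q)
  count-↭ p (swap {xs} {ys} x y q) rewrite count-↭ p q
    | ≡-sym (+-assoc (bit (p x)) (bit (p y)) (count p ys)) | +-comm (bit (p x)) (bit (p y)) =
    +-assoc (bit (p y)) (bit (p x)) (count p ys)
  count-↭ p (trans q r) = ≡-trans (count-↭ p q) (count-↭ p r)

  count-++ : ∀ (p : V → Bool) xs ys → count p (xs ++ ys) ≡ count p xs + count p ys
  count-++ p [] ys = refl
  count-++ p (x ∷ xs) ys rewrite count-++ p xs ys = ≡-sym (+-assoc (bit (p x)) (count p xs) (count p ys))

  count-all : ∀ (p : V → Bool) {xs} → All (λ x → p x ≡ true) xs → count p xs ≡ length xs
  count-all p [] = refl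
  count-all p (q ∷ qs) rewrite q = cong suc (count-all p qs)

  count-none : ∀ (p : V → Bool) {xs} → All (λ x → p x ≡ false) xs → count p xs ≡ 0
  count-none p [] = refl
  count-none p (q ∷ qs) rewrite q = count-none p qs

  record Partition (p : V → Bool) (xs : List V) : Set where
    constructor partition
    field
      {yess noes} : List V
      split-↭ : xs ↭ yess ++ noes
      hold    : All (λ x → p x ≡ true) yess
      fail    : All (λ x → p x ≡ false) noes

    length-yess : length yess ≡ count p xs
    length-yess rewrite count-↭ p split-↭ | count-++ p yess noes | count-none p fail
      | +-identityʳ (count p yess) = ≡-sym (count-all p hold)

    length-sum : length yess + length noes ≡ length xs
    length-sum = ≡-trans (≡-sym (length-++ yess)) (≡-sym (↭-length split-↭))

  part : ∀ (p : V → Bool) xs → Partition p xs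
  part p [] = partition ↭-refl [] []
  part p (x ∷ xs) with p x in eq | part p xs
  ... | true  | partition q ts fs = partition (prep x q) (eq ∷ ts) fs
  ... | false | partition {ys} {zs} q ts fs =
    partition (↭-trans (prep x q) (↭-sym (shift x ys zs))) ts (eq ∷ fs)

  extract : ∀ (P : V → Set) → (∀ x → Dec (P x)) → ∀ xs →
            (∃₂ λ x ys → xs ↭ x ∷ ys × P x) ⊎ All (λ x → ¬ P x) xs
  extract P P? [] = inj₂ []
  extract P P? (x ∷ xs) with P? x | extract P P? xs
  ... | yes px | _ = inj₁ (x , xs , ↭-refl , px)
  ... | no _   | inj₁ (y , ys , p , py) = inj₁ (y , x ∷ ys , ↭-trans (prep x p) (swap x y ↭-refl) , py)
  ... | no ¬p  | inj₂ ¬ps = inj₂ (¬p ∷ ¬ps)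

-- Turns a list of vertices into a labelling by numbers. The default `d` serves only labels past the
-- end of the list, which the trees do not use.
at : ∀ {V : Set} → V → List V → ℕ → V
at d []       _       = d
at d (x ∷ xs) zero    = x
at d (x ∷ xs) (suc i) = at d xs i

-- Independent sets in triangle-free graphs.

module TriangleFree {V : Set} (R : V → V → Bool) (R-sym : ∀ x y → R x y ≡ R y x)
  (no-triangle : ∀ {x y z} → R x y ≡ true → R y z ≡ true → R x z ≡ true → ⊥) where

  Adj Non : V → V → Set
  Adj x y = R x y ≡ true
  Non x y = R x y ≡ false

  Indep : List V → Set
  Indep = AllPairs Non

  Adj-sym : ∀ {x y} → Adj x y → Adj y x
  Adj-sym = ≡-trans (R-sym _ _)

  Non-sym : ∀ {x y} → Non x y → Non y x
  Non-sym = ≡-trans (R-sym _ _)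

  common : ∀ {x y z} → Adj y x → Adj y z → Non x z
  common {x} {_} {z} p q with R x z in eq
  ... | false = refl
  ... | true  = ⊥-elim (no-triangle (Adj-sym p) q eq)

  neighbours-indep : ∀ {v xs} → All (Adj v) xs → Indep xs
  neighbours-indep []       = []
  neighbours-indep (p ∷ ps) = All.map (common p) ps ∷ neighbours-indep ps

  -- The remaining vertices are kept, so that further sets can be taken from them.
  record Contains (k : ℕ) (xs : List V) : Set where
    constructor contains
    field
      {set rest} : List V
      size  : length set ≡ k
      indep : Indep set
      perm  : xs ↭ set ++ rest

    rest-size : k + length rest ≡ length xs
    rest-size = ≡-trans (cong (_+ length rest) (≡-sym size))
      (≡-trans (≡-sym (length-++ set)) (≡-sym (↭-length perm)))

  ramsey₂ : ∀ {xs} → 3 ≤ length xs → Contains 2 xs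
  ramsey₂ {a ∷ b ∷ c ∷ xs} _ with R a b in ab | R a c in ac
  ... | false | _     = contains {set = a ∷ b ∷ []} refl ((ab ∷ []) ∷ [] ∷ []) ↭-refl
  ... | true  | false = contains {set = a ∷ c ∷ []} refl ((ac ∷ []) ∷ [] ∷ []) (prep a (swap b c ↭-refl))
  ... | true  | true  = contains {set = b ∷ c ∷ []} refl ((common ab ac ∷ []) ∷ [] ∷ [])
    (↭-trans (swap a b ↭-refl) (prep b (swap a c ↭-refl)))
  ramsey₂ {_ ∷ []} (s≤s ())
  ramsey₂ {_ ∷ _ ∷ []} (s≤s (s≤s ()))

  Contains-∷ : ∀ {v k xs} → All (Non v) xs → Contains k xs → Contains (suc k) (v ∷ xs)
  Contains-∷ {v} vs (contains refl i p) =
    contains refl (All.++⁻ˡ _ (All-resp-↭ p vs) ∷ i) (prep v p)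

  Contains-++ : ∀ {k xs} ys → Contains k xs → Contains k (xs ++ ys)
  Contains-++ ys (contains {s} {r} refl i p) =
    contains refl i (↭-trans (++⁺ʳ ys p) (↭-reflexive (++-assoc s r ys)))

  Contains-resp-↭ : ∀ {k xs ys} → xs ↭ ys → Contains k ys → Contains k xs
  Contains-resp-↭ p (contains s i q) = contains s i (↭-trans p q)

  Contains-clique : ∀ k {xs} → k ≤ length xs → Indep xs → Contains k xs
  Contains-clique k {xs} h i = contains
    (≡-trans (length-take k xs) (m≤n⇒m⊓n≡m h)) (AllPairs.take⁺ k i)
    (↭-reflexive (≡-sym (take++drop≡id k xs)))

  -- The bound r(3,3) ≤ 6. Three neighbours of x are independent; otherwise x has three
  -- nonneighbours, and two nonadjacent ones among them form a triple with x.
  ramsey₃ : ∀ {xs} → 6 ≤ length xs → Contains 3 xs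
  ramsey₃ {x ∷ xs} (s≤s h) with part (R x) xs
  ... | P@(partition {ys} {zs} p as bs) with 3 ≤? length ys
  ... | yes q = Contains-resp-↭ (prep x p)
    (Contains-resp-↭ (↭-sym (shift x ys zs)) (Contains-++ (x ∷ zs) (Contains-clique 3 q (neighbours-indep as))))
  ... | no ¬q = Contains-resp-↭ (↭-trans (prep x p) (prep x (++-comm ys zs)))
    (Contains-++ ys (Contains-∷ bs (ramsey₂ (+-cancelˡ-≤ 2 3 _ (≤-trans h
      (≤-trans (≤-reflexive (≡-sym (Partition.length-sum P))) (+-monoˡ-≤ (length zs) (≤-pred (≰⇒> ¬q)))))))))

  -- Checking the decision trees.

  module Certificate (f : ℕ → V) where

    Sound : List Fact → Set
    Sound = All (λ { (i , j , b) → R (f i) (f j) ≡ b })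

    fact : ∀ b fs i j → Maybe (Sound fs → R (f i) (f j) ≡ b)
    fact b [] i j = nothing
    fact b ((k , l , c) ∷ fs) i j with c Bool.≟ b | i ≟ k | j ≟ l | i ≟ l | j ≟ k
    ... | yes refl | yes refl | yes refl | _ | _ = just All.head
    ... | yes refl | _ | _ | yes refl | yes refl = just λ s → ≡-trans (R-sym _ _) (All.head s)
    ... | _ | _ | _ | _ | _ = Maybe.map (λ g s → g (All.tail s)) (fact b fs i j)

    -- fs₀ is the part of fs still to be scanned for an edge from i to a neighbour of j.
    via : ∀ fs₀ fs i j → Maybe (Sound fs₀ → Sound fs → Non (f i) (f j))
    via [] fs i j = nothing
    via ((k , l , false) ∷ fs₀) fs i j = Maybe.map (λ g s → g (All.tail s)) (via fs₀ fs i j)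
    via ((k , l , true) ∷ fs₀) fs i j with i ≟ k | i ≟ l
    ... | yes refl | _ =
      Maybe.map (λ g s t → common (Adj-sym (All.head s)) (g t)) (fact true fs l j)
        <∣> Maybe.map (λ g s → g (All.tail s)) (via fs₀ fs i j)
    ... | _ | yes refl =
      Maybe.map (λ g s t → common (All.head s) (g t)) (fact true fs k j)
        <∣> Maybe.map (λ g s → g (All.tail s)) (via fs₀ fs i j)
    ... | no _ | no _ = Maybe.map (λ g s → g (All.tail s)) (via fs₀ fs i j)

    -- Either the pair is recorded as nonadjacent, or the recorded edges give it a common neighbour,
    -- which excludes an edge in a triangle-free graph.
    nonadjacent : ∀ fs i j → Maybe (Sound fs → Non (f i) (f j))
    nonadjacent fs i j = fact false fs i j <∣> Maybe.map (λ g s → g s s) (via fs fs i j)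

    NonAdj : ℕ → ℕ → Set
    NonAdj i j = Non (f i) (f j)

    all-nonadjacent : ∀ fs i js → Maybe (Sound fs → All (NonAdj i) js)
    all-nonadjacent fs i [] = just λ _ → []
    all-nonadjacent fs i (j ∷ js) =
      zipWith (λ g h s → g s ∷ h s) (nonadjacent fs i j) (all-nonadjacent fs i js)

    independent : ∀ fs is → Maybe (Sound fs → AllPairs NonAdj is)
    independent fs [] = just λ _ → []
    independent fs (i ∷ is) =
      zipWith (λ g h s → g s ∷ h s) (all-nonadjacent fs i is) (independent fs is)

    quadruple : ∀ {n} fs xs a b c d → (∀ ys → Maybe (Sound fs → Packs NonAdj n ys)) →
                Maybe (Sound fs → Packs NonAdj (suc n) xs)
    quadruple fs xs a b c d k =
      pick a xs >>= λ { (xs₁ , p₁) → pick b xs₁ >>= λ { (xs₂ , p₂) →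
      pick c xs₂ >>= λ { (xs₃ , p₃) → pick d xs₃ >>= λ { (ys , p₄) →
      zipWith (λ g h s → pack (↭-trans p₁ (prep a (↭-trans p₂ (prep b (↭-trans p₃ (prep c p₄)))))) (g s) (h s))
        (independent fs (a ∷ b ∷ c ∷ d ∷ [])) (k ys) }}}}

    by-cases : ∀ {A : Set} {fs} i j → (Sound ((i , j , true) ∷ fs) → A) →
               (Sound ((i , j , false) ∷ fs) → A) → Sound fs → A
    by-cases i j g h s with R (f i) (f j) in eq
    ... | true  = g (eq ∷ s)
    ... | false = h (eq ∷ s)

    -- Yields `just` only if at every leaf the quadruples are disjoint, lie in `xs` and are
    -- independent by the facts of that branch. `from-just` then makes a failed check a type error.
    solve : ∀ {n} → Tree n → ∀ xs fs → Maybe (Sound fs → Packs NonAdj n xs)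
    solve (one a b c d) xs fs = quadruple fs xs a b c d λ _ → just λ _ → none
    solve (two a b c d a′ b′ c′ d′) xs fs =
      quadruple fs xs a b c d λ ys → quadruple fs ys a′ b′ c′ d′ λ _ → just λ _ → none
    solve (split i j t u) xs fs =
      zipWith (by-cases i j) (solve t xs ((i , j , true) ∷ fs)) (solve u xs ((i , j , false) ∷ fs))

  -- The bound r(3,4) ≤ 9.

  triple : ∀ {a b c} → Non a b → Non a c → Non b c → Indep (a ∷ b ∷ c ∷ [])
  triple ab ac bc = (ab ∷ ac ∷ []) ∷ (bc ∷ []) ∷ [] ∷ []

  data FiveCycle (v : V) (xs : List V) : Set where
    five-cycle : ∀ {p q r s} → xs ↭ v ∷ p ∷ q ∷ r ∷ s ∷ [] →
                 Adj v p → Adj p q → Adj q r → Adj r s → Adj s v → FiveCycle v xs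

  -- The five-cycle is the only triangle-free graph on five vertices without an independent triple.
  -- Three neighbours or three nonneighbours of v give a triple at once, so two of each remain: p, q
  -- and r, s.
  five-vertices : ∀ v {xs} → length xs ≡ 4 → Contains 3 (v ∷ xs) ⊎ FiveCycle v (v ∷ xs)
  five-vertices v {xs} h with part (R v) xs
  ... | partition {ys@(_ ∷ _ ∷ _ ∷ _)} {zs} p as bs =
    inj₁ (Contains-resp-↭ (prep v p) (Contains-resp-↭ (↭-sym (shift v ys zs))
      (Contains-++ (v ∷ zs) (Contains-clique 3 (s≤s (s≤s (s≤s z≤n))) (neighbours-indep as)))))
  ... | partition {ys} {zs@(_ ∷ _ ∷ _ ∷ _)} p as bs =
    inj₁ (Contains-resp-↭ (↭-trans (prep v p) (prep v (++-comm ys zs)))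
      (Contains-++ ys (Contains-∷ bs (ramsey₂ (s≤s (s≤s (s≤s z≤n)))))))
  ... | partition {p ∷ q ∷ []} {r ∷ s ∷ []} π (vp ∷ vq ∷ []) (vr ∷ vs ∷ []) = go
    where
    pq = common vp vq
    Goal = Contains 3 (v ∷ xs) ⊎ FiveCycle v (v ∷ xs)
    independent-triple : ∀ {a b c ys} → p ∷ q ∷ r ∷ s ∷ [] ↭ a ∷ b ∷ c ∷ ys →
      Non a b → Non a c → Non b c → Goal
    independent-triple {ys = ys} ρ ab ac bc =
      inj₁ (Contains-resp-↭ (↭-trans (prep v (↭-trans π ρ)) (↭-sym (shift v _ ys)))
        (contains refl (triple ab ac bc) ↭-refl))
    pqsr : p ∷ q ∷ r ∷ s ∷ [] ↭ p ∷ q ∷ s ∷ r ∷ []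
    pqsr = prep p (prep q (swap r s ↭-refl))
    go : Goal
    -- If rs is an edge, neither p nor q is adjacent to both r and s. If r or s is adjacent to
    -- neither of p, q, it forms a triple with them. Otherwise the edges between the pairs are a
    -- matching and close a five-cycle.
    go with R r s in rs | R p r in pr | R p s in ps | R q r in qr | R q s in qs
    ... | false | _ | _ | _ | _ = inj₁ (Contains-resp-↭ (prep v (↭-trans π (++-comm (p ∷ q ∷ []) _)))
      (contains refl (triple vr vs rs) ↭-refl))
    ... | true | true | true | _ | _ = ⊥-elim (no-triangle pr rs ps)
    ... | true | _ | _ | true | true = ⊥-elim (no-triangle qr rs qs)
    ... | true | false | _ | false | _ = independent-triple ↭-refl pq pr qr
    ... | true | _ | false | _ | false = independent-triple pqsr pq ps qs
    ... | true | true | false | false | true =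
      inj₂ (five-cycle (prep v (↭-trans π (prep p (↭-trans (swap q r ↭-refl) (prep r (swap q s ↭-refl))))))
        vp pr rs (Adj-sym qs) (Adj-sym vq))
    ... | true | false | true | true | false =
      inj₂ (five-cycle (prep v (↭-trans π (↭-trans pqsr (prep p (↭-trans (swap q s ↭-refl) (prep s (swap q r ↭-refl)))))))
        vp ps (Adj-sym rs) (Adj-sym qr) (Adj-sym vq))
  five-vertices v h | P@(partition {[]} {[]} _ _ _) with () ← ≡-trans (Partition.length-sum P) h
  five-vertices v h | P@(partition {[]} {_ ∷ []} _ _ _) with () ← ≡-trans (Partition.length-sum P) h
  five-vertices v h | P@(partition {[]} {_ ∷ _ ∷ []} _ _ _) with () ← ≡-trans (Partition.length-sum P) h
  five-vertices v h | P@(partition {_ ∷ []} {[]} _ _ _) with () ← ≡-trans (Partition.length-sum P) h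
  five-vertices v h | P@(partition {_ ∷ []} {_ ∷ []} _ _ _) with () ← ≡-trans (Partition.length-sum P) h
  five-vertices v h | P@(partition {_ ∷ []} {_ ∷ _ ∷ []} _ _ _) with () ← ≡-trans (Partition.length-sum P) h
  five-vertices v h | P@(partition {_ ∷ _ ∷ []} {[]} _ _ _) with () ← ≡-trans (Partition.length-sum P) h
  five-vertices v h | P@(partition {_ ∷ _ ∷ []} {_ ∷ []} _ _ _) with () ← ≡-trans (Partition.length-sum P) h

  Contains⇒Packs : ∀ {xs} → Contains 4 xs → Packs Non 1 xs
  Contains⇒Packs (contains {_ ∷ _ ∷ _ ∷ _ ∷ []} refl i p) = pack p i none

  Packs⇒Contains : ∀ {xs} → Packs Non 1 xs → Contains 4 xs
  Packs⇒Contains (pack p i _) = contains refl i p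

  -- Four neighbours of v are independent, and six nonneighbours contain a triple that extends by v.
  -- What remains is three neighbours and five nonneighbours; the latter contain such a triple or
  -- form a five-cycle, and `nine-tree` settles the five-cycle.
  nine-vertices : ∀ {xs} → length xs ≡ 9 → Contains 4 xs
  nine-vertices {v ∷ xs} h with part (R v) xs
  ... | P@(partition {ns} {ms} p as bs) with 4 ≤? length ns | 6 ≤? length ms
  ... | yes q | _ = Contains-resp-↭ (↭-trans (prep v p) (↭-sym (shift v ns ms)))
    (Contains-++ (v ∷ ms) (Contains-clique 4 q (neighbours-indep as)))
  ... | no _ | yes q = Contains-resp-↭ (↭-trans (prep v p) (prep v (++-comm ns ms)))
    (Contains-++ ns (Contains-∷ bs (ramsey₃ q)))
  ... | no ¬a | no ¬b = tight p as bs (≤-pred (≰⇒> ¬a)) (≤-pred (≰⇒> ¬b)) (≡-trans (Partition.length-sum P) (suc-injective h))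
    where
    tight : ∀ {xs ns ms} → xs ↭ ns ++ ms → All (Adj v) ns → All (Non v) ms →
            length ns ≤ 3 → length ms ≤ 5 → length ns + length ms ≡ 8 → Contains 4 (v ∷ xs)
    tight {ns = a ∷ b ∷ c ∷ []} {m ∷ ms} p as@(va ∷ vb ∷ vc ∷ []) bs _ _ e
      with five-vertices m (suc-injective (suc-injective (suc-injective (suc-injective e))))
    ... | inj₁ t = Contains-resp-↭ (↭-trans (prep v p) (prep v (++-comm (a ∷ b ∷ c ∷ []) (m ∷ ms))))
      (Contains-++ _ (Contains-∷ bs t))
    ... | inj₂ (five-cycle {i} {j} {k} {l} q mi ij jk kl lm) =
      Contains-resp-↭ (prep v (↭-trans p (prep a (prep b (prep c q)))))
        (Packs⇒Contains (Packs-map f id (from-just (Certificate.solve f nine-tree (upTo 9) nine-facts)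
          (va ∷ vb ∷ vc ∷ mi ∷ ij ∷ jk ∷ kl ∷ lm ∷ []))))
      where f = at v (v ∷ a ∷ b ∷ c ∷ m ∷ i ∷ j ∷ k ∷ l ∷ [])
    tight {ns = []} _ _ _ _ b e = ⊥-elim (<⇒≱ (s≤s (≤-trans b (s≤s (s≤s (s≤s (s≤s (s≤s z≤n))))))) (≤-reflexive (≡-sym e)))
    tight {ns = _ ∷ []} _ _ _ _ b e = ⊥-elim (<⇒≱ (s≤s (≤-trans b (s≤s (s≤s (s≤s (s≤s (s≤s z≤n))))))) (≤-reflexive (≡-sym (suc-injective e))))
    tight {ns = _ ∷ _ ∷ []} _ _ _ _ b e = ⊥-elim (<⇒≱ (s≤s b) (≤-reflexive (≡-sym (suc-injective (suc-injective e)))))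
    tight {ns = _ ∷ _ ∷ _ ∷ _ ∷ _} _ _ _ (s≤s (s≤s (s≤s ()))) _ _
    tight {ns = _ ∷ _ ∷ _ ∷ []} {[]} _ _ _ _ _ ()

  ramsey₄ : ∀ {xs} → 9 ≤ length xs → Contains 4 xs
  ramsey₄ {xs} h = Contains-resp-↭ (↭-reflexive (≡-sym (take++drop≡id 9 xs)))
    (Contains-++ (drop 9 xs) (nine-vertices (≡-trans (length-take 9 xs) (m≤n⇒m⊓n≡m h))))

  -- Two disjoint independent quadruples among eleven vertices.

  two-disjoint : ∀ {as bs xs} → Contains 4 as → Contains 4 bs → xs ↭ as ++ bs → Packs Non 2 xs
  two-disjoint {bs = bs} (contains {_ ∷ _ ∷ _ ∷ _ ∷ []} {rest} refl i p) B q =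
    pack (↭-trans q (++⁺ʳ bs p)) i
      (Packs-resp-↭ (++-comm rest bs) (Packs-++ rest (Contains⇒Packs B)))

  -- A loop would be a triangle with three equal vertices, which `no-triangle` excludes as well.
  Non-refl : ∀ x → Non x x
  Non-refl x with R x x in eq
  ... | false = refl
  ... | true  = ⊥-elim (no-triangle eq eq eq)

  -- The neighbours of the members of `qs` are deleted one member at a time, and each member costs
  -- at most two vertices.
  avoiding : ∀ qs {ms} → All (λ q → count (R q) ms ≤ 2) qs → ∃₂ λ zs ws →
    ms ↭ zs ++ ws × All (λ z → All (λ q → Non q z) qs) zs × length ms ≤ length zs + length qs * 2
  avoiding [] {ms} [] = ms , [] , ↭-reflexive (≡-sym (++-identityʳ ms)) , All.tabulate (λ _ → []) ,
    m≤m+n (length ms) 0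
  avoiding (q ∷ qs) {ms} (c ∷ cs) with part (R q) ms
  ... | P@(partition {ys} {ns} p _ bs) with avoiding qs {ns} (All.map (λ {r} → ≤-trans (smaller r)) cs)
    where
    smaller : ∀ r → count (R r) ns ≤ count (R r) ms
    smaller r = ≤-trans (m≤n+m _ (count (R r) ys))
      (≤-reflexive (≡-sym (≡-trans (count-↭ (R r) p) (count-++ (R r) ys ns))))
  ... | zs , ws , π , avoid , h = zs , ws ++ ys ,
    ↭-trans p (↭-trans (++-comm ys ns) (↭-trans (++⁺ʳ ys π) (↭-reflexive (++-assoc zs ws ys)))) ,
    All.zipWith (λ { (b , a) → b ∷ a }) (All.++⁻ˡ zs (All-resp-↭ π bs) , avoid) , (begin
      length ms                              ≡⟨ ≡-sym (Partition.length-sum P) ⟩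
      length ys + length ns                  ≤⟨ +-mono-≤ (≤-trans (≤-reflexive (Partition.length-yess P)) c) h ⟩
      2 + (length zs + length qs * 2)        ≡⟨ ≡-sym (+-assoc 2 (length zs) _) ⟩
      2 + length zs + length qs * 2          ≡⟨ cong (_+ length qs * 2) (+-comm 2 (length zs)) ⟩
      length zs + 2 + length qs * 2          ≡⟨ +-assoc (length zs) 2 _ ⟩
      length zs + suc (length qs) * 2        ∎)
    where open ≤-Reasoning

  -- Extend the neighbourhood of s to an independent quadruple; six further vertices are not
  -- adjacent to s, and an independent triple among them forms with s the second quadruple.
  low-degree : ∀ {s ys} → length ys ≡ 10 → All (λ x → count (R x) (s ∷ ys) ≤ 3) (s ∷ ys) →
               Packs Non 2 (s ∷ ys)
  low-degree {s} {ys} len (cap ∷ caps) with part (R s) ys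
  ... | P@(partition {ns} {ms} p as bs) with avoiding ns {ms}
    (All.zipWith (λ { {x} (c , a) → reduce x c a }) (All.++⁻ˡ ns (All-resp-↭ p caps) , as))
    where
    -- One of the at most three neighbours of x is s itself.
    reduce : ∀ x → count (R x) (s ∷ ys) ≤ 3 → Adj s x → count (R x) ms ≤ 2
    reduce x c a rewrite Adj-sym a = ≤-trans (m≤n+m _ (count (R x) ns))
      (≤-trans (≤-reflexive (≡-sym (≡-trans (count-↭ (R x) p) (count-++ (R x) ns ms)))) (≤-pred c))
  ... | zs , ws , π , avoid , h = finish (extension ns few total h)
    where
    few : length ns ≤ 3
    few = ≤-trans (≤-reflexive (Partition.length-yess P)) (≤-trans (m≤n+m _ (bit (R s s))) cap)
    total : length ns + length ms ≡ 10
    total = ≡-trans (Partition.length-sum P) len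
    -- With d neighbours of s there are 10 - d nonneighbours, and at least 10 - 3d of them avoid all
    -- of `ns`. These 10, 7, 4 or 1 vertices contain 4, 3, 2 or 1 independent ones respectively.
    extension : ∀ ns → length ns ≤ 3 → length ns + length ms ≡ 10 →
      length ms ≤ length zs + length ns * 2 → ∃ λ k → length ns + k ≡ 4 × Contains k zs
    extension [] _ e h = 4 , refl , ramsey₄ (≤-trans (n≤1+n 9) (≤-trans (≤-reflexive (≡-sym e)) (≤-trans h (≤-reflexive (+-identityʳ _)))))
    extension (_ ∷ []) _ e h = 3 , refl , ramsey₃ (≤-trans (n≤1+n 6) (+-cancelʳ-≤ 2 7 _ (≤-trans (≤-reflexive (≡-sym (suc-injective e))) h)))
    extension (_ ∷ _ ∷ []) _ e h = 2 , refl , ramsey₂ (≤-trans (n≤1+n 3) (+-cancelʳ-≤ 4 4 _ (≤-trans (≤-reflexive (≡-sym (suc-injective (suc-injective e)))) h)))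
    extension (_ ∷ _ ∷ _ ∷ []) _ e h = 1 , refl , singleton (+-cancelʳ-≤ 6 1 _ (≤-trans (≤-reflexive (≡-sym (suc-injective (suc-injective (suc-injective e))))) h))
      where
      singleton : ∀ {zs} → 1 ≤ length zs → Contains 1 zs
      singleton {_ ∷ _} _ = contains refl ([] ∷ []) ↭-refl
    extension (_ ∷ _ ∷ _ ∷ _ ∷ _) (s≤s (s≤s (s≤s ()))) _ _
    finish : (∃ λ k → length ns + k ≡ 4 × Contains k zs) → Packs Non 2 (s ∷ ys)
    finish (k , e , contains {set} {rest} refl i q) = two-disjoint
      (Contains-clique 4 (≤-reflexive (≡-sym size)) quad)
      (Contains-∷ others (ramsey₃ (≤-reflexive (≡-sym six))))
      (↭-trans (prep s total-perm) (↭-sym (shift s (ns ++ set) (rest ++ ws))))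
      where
      size : length (ns ++ set) ≡ 4
      size = ≡-trans (length-++ ns) e
      quad : Indep (ns ++ set)
      quad = AllPairs.++⁺ (neighbours-indep as) i
        (All.All-swap (All.++⁻ˡ set (All-resp-↭ q avoid)))
      ms-perm : ms ↭ set ++ (rest ++ ws)
      ms-perm = ↭-trans π (↭-trans (++⁺ʳ ws q) (↭-reflexive (++-assoc set rest ws)))
      total-perm : ys ↭ (ns ++ set) ++ (rest ++ ws)
      total-perm = ↭-trans p (↭-trans (++⁺ˡ ns ms-perm) (↭-reflexive (≡-sym (++-assoc ns set (rest ++ ws)))))
      others : All (Non s) (rest ++ ws)
      others = All.++⁻ʳ set (All-resp-↭ ms-perm bs)
      six : length (rest ++ ws) ≡ 6
      six = +-cancelˡ-≡ 4 _ _ (≡-trans (cong (_+ length (rest ++ ws)) (≡-sym size))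
        (≡-trans (≡-sym (length-++ (ns ++ set))) (≡-trans (≡-sym (↭-length total-perm)) len)))

  cycle-many : ∀ {v a b c d e m i j k l} → All (Adj v) (a ∷ b ∷ c ∷ d ∷ e ∷ []) →
    All (Adj m) (a ∷ b ∷ c ∷ []) → All (Non v) (m ∷ i ∷ j ∷ k ∷ l ∷ []) →
    Adj m i → Adj i j → Adj j k → Adj k l → Adj l m →
    Packs Non 2 (v ∷ a ∷ b ∷ c ∷ d ∷ e ∷ m ∷ i ∷ j ∷ k ∷ l ∷ [])
  cycle-many {v} {a} {b} {c} {d} {e} {m} {i} {j} {k} {l} (va ∷ vb ∷ vc ∷ vd ∷ ve ∷ []) (ma ∷ mb ∷ mc ∷ [])
    (vm ∷ vi ∷ vj ∷ vk ∷ vl ∷ []) mi ij jk kl lm =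
    -- The proofs are supplied in the order of the facts.
    Packs-map f id (from-just (Certificate.solve f cycle-tree-many (upTo 11)
        (star 0 false (6 ∷ 7 ∷ 8 ∷ 9 ∷ 10 ∷ []) ++ star 6 true (1 ∷ 2 ∷ 3 ∷ []) ++ cycle-facts))
      (vm ∷ vi ∷ vj ∷ vk ∷ vl ∷ ma ∷ mb ∷ mc ∷ va ∷ vb ∷ vc ∷ vd ∷ ve ∷ mi ∷ ij ∷ jk ∷ kl ∷ lm ∷ []))
    where f = at v (v ∷ a ∷ b ∷ c ∷ d ∷ e ∷ m ∷ i ∷ j ∷ k ∷ l ∷ [])

  cycle-few : ∀ {v a b c d e m i j k l} → All (Adj v) (a ∷ b ∷ c ∷ d ∷ e ∷ []) →
    All (Non m) (a ∷ b ∷ c ∷ []) → All (Non v) (m ∷ i ∷ j ∷ k ∷ l ∷ []) →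
    Adj m i → Adj i j → Adj j k → Adj k l → Adj l m →
    Packs Non 2 (v ∷ a ∷ b ∷ c ∷ d ∷ e ∷ m ∷ i ∷ j ∷ k ∷ l ∷ [])
  cycle-few {v} {a} {b} {c} {d} {e} {m} {i} {j} {k} {l} (va ∷ vb ∷ vc ∷ vd ∷ ve ∷ []) (ma ∷ mb ∷ mc ∷ [])
    (vm ∷ vi ∷ vj ∷ vk ∷ vl ∷ []) mi ij jk kl lm =
    Packs-map f id (from-just (Certificate.solve f cycle-tree-few (upTo 11)
        (star 0 false (6 ∷ 7 ∷ 8 ∷ 9 ∷ 10 ∷ []) ++ star 6 false (1 ∷ 2 ∷ 3 ∷ []) ++ cycle-facts))
      (vm ∷ vi ∷ vj ∷ vk ∷ vl ∷ ma ∷ mb ∷ mc ∷ va ∷ vb ∷ vc ∷ vd ∷ ve ∷ mi ∷ ij ∷ jk ∷ kl ∷ lm ∷ []))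
    where f = at v (v ∷ a ∷ b ∷ c ∷ d ∷ e ∷ m ∷ i ∷ j ∷ k ∷ l ∷ [])

  edge4-many : ∀ {v a b c d e g m i j k} → All (Adj v) (a ∷ b ∷ c ∷ d ∷ e ∷ g ∷ []) →
    All (Adj m) (a ∷ b ∷ c ∷ []) → All (Non v) (m ∷ i ∷ j ∷ k ∷ []) → Adj m i →
    Packs Non 2 (v ∷ a ∷ b ∷ c ∷ d ∷ e ∷ g ∷ m ∷ i ∷ j ∷ k ∷ [])
  edge4-many {v} {a} {b} {c} {d} {e} {g} {m} {i} {j} {k} (va ∷ vb ∷ vc ∷ vd ∷ ve ∷ vg ∷ []) (ma ∷ mb ∷ mc ∷ [])
    (vm ∷ vi ∷ vj ∷ vk ∷ []) mi =
    Packs-map f id (from-just (Certificate.solve f edge4-tree-many (upTo 11) (star 7 true (1 ∷ 2 ∷ 3 ∷ []) ++ edge4-facts))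
      (ma ∷ mb ∷ mc ∷ va ∷ vb ∷ vc ∷ vd ∷ ve ∷ vg ∷ vm ∷ vi ∷ vj ∷ vk ∷ mi ∷ []))
    where f = at v (v ∷ a ∷ b ∷ c ∷ d ∷ e ∷ g ∷ m ∷ i ∷ j ∷ k ∷ [])

  edge4-few : ∀ {v a b c d e g m i j k} → All (Adj v) (a ∷ b ∷ c ∷ d ∷ e ∷ g ∷ []) →
    All (Non m) (a ∷ b ∷ c ∷ d ∷ []) → All (Non v) (m ∷ i ∷ j ∷ k ∷ []) → Adj m i →
    Packs Non 2 (v ∷ a ∷ b ∷ c ∷ d ∷ e ∷ g ∷ m ∷ i ∷ j ∷ k ∷ [])
  edge4-few {v} {a} {b} {c} {d} {e} {g} {m} {i} {j} {k} (va ∷ vb ∷ vc ∷ vd ∷ ve ∷ vg ∷ []) (ma ∷ mb ∷ mc ∷ md ∷ [])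
    (vm ∷ vi ∷ vj ∷ vk ∷ []) mi =
    Packs-map f id (from-just (Certificate.solve f edge4-tree-few (upTo 11) (star 7 false (1 ∷ 2 ∷ 3 ∷ 4 ∷ []) ++ edge4-facts))
      (ma ∷ mb ∷ mc ∷ md ∷ va ∷ vb ∷ vc ∷ vd ∷ ve ∷ vg ∷ vm ∷ vi ∷ vj ∷ vk ∷ mi ∷ []))
    where f = at v (v ∷ a ∷ b ∷ c ∷ d ∷ e ∷ g ∷ m ∷ i ∷ j ∷ k ∷ [])

  edge3 : ∀ {v a b c d e g h m i j} → All (Adj v) (a ∷ b ∷ c ∷ d ∷ e ∷ g ∷ h ∷ []) →
    All (Non v) (m ∷ i ∷ j ∷ []) → Adj m i →
    Packs Non 2 (v ∷ a ∷ b ∷ c ∷ d ∷ e ∷ g ∷ h ∷ m ∷ i ∷ j ∷ [])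
  edge3 {v} {a} {b} {c} {d} {e} {g} {h} {m} {i} {j} (va ∷ vb ∷ vc ∷ vd ∷ ve ∷ vg ∷ vh ∷ []) (vm ∷ vi ∷ vj ∷ []) mi =
    Packs-map f id (from-just (Certificate.solve f edge3-tree (upTo 11) edge3-facts)
      (va ∷ vb ∷ vc ∷ vd ∷ ve ∷ vg ∷ vh ∷ vm ∷ vi ∷ vj ∷ mi ∷ []))
    where f = at v (v ∷ a ∷ b ∷ c ∷ d ∷ e ∷ g ∷ h ∷ m ∷ i ∷ j ∷ [])

  edge-or-indep : ∀ xs → (∃₂ λ a b → ∃ λ ys → xs ↭ a ∷ b ∷ ys × Adj a b) ⊎ Indep xs
  edge-or-indep [] = inj₂ []
  edge-or-indep (x ∷ xs) with part (R x) xs | edge-or-indep xs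
  ... | partition {y ∷ ys} {zs} p (a ∷ _) _ | _ = inj₁ (x , y , ys ++ zs , prep x p , a)
  ... | _ | inj₁ (a , b , ys , p , ab) = inj₁ (a , b , x ∷ ys ,
    ↭-trans (prep x p) (↭-sym (shift x (a ∷ b ∷ []) ys)) , ab)
  ... | partition {[]} p _ bs | inj₂ i = inj₂ (All-resp-↭ (↭-sym p) bs ∷ i)

  module _ {v : V} where

    three-nonneighbours : ∀ {a b ns ms} → All (Adj v) ns → All (Non v) (a ∷ b ∷ ms) → Adj a b →
      length ns ≡ 7 → length ms ≡ 1 → Packs Non 2 (v ∷ ns ++ a ∷ b ∷ ms)
    three-nonneighbours {ns = _ ∷ _ ∷ _ ∷ _ ∷ _ ∷ _ ∷ _ ∷ []} {_ ∷ []} as bs ab refl refl = edge3 as bs ab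

    -- Of the six neighbours of v, three are adjacent to a or four are not; each case has its own
    -- tree.
    four-nonneighbours : ∀ {a b ns ms} → All (Adj v) ns → All (Non v) (a ∷ b ∷ ms) → Adj a b →
      length ns ≡ 6 → length ms ≡ 2 → Packs Non 2 (v ∷ ns ++ a ∷ b ∷ ms)
    four-nonneighbours {a} {b} {ns} {ms} as bs ab six pair with part (R a) ns
    ... | P@(partition {ys} {zs} p hs fs) with 3 ≤? length ys
    ... | yes q = Packs-resp-↭ (prep v (++⁺ʳ _ p))
      (many hs q (All-resp-↭ p as) bs pair (≡-trans (≡-sym (↭-length p)) six))
      where
      many : ∀ {ys zs ms} → All (Adj a) ys → 3 ≤ length ys → All (Adj v) (ys ++ zs) → All (Non v) (a ∷ b ∷ ms) →
        length ms ≡ 2 → length (ys ++ zs) ≡ 6 → Packs Non 2 (v ∷ (ys ++ zs) ++ a ∷ b ∷ ms)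
      many {_ ∷ _ ∷ _ ∷ ys} {zs} {_ ∷ _ ∷ []} (p ∷ q ∷ r ∷ _) _ as bs refl e with ys ++ zs
      ... | _ ∷ _ ∷ _ ∷ [] = edge4-many as (p ∷ q ∷ r ∷ []) bs ab
      many {_ ∷ []} _ (s≤s ()) _ _ _ _
      many {_ ∷ _ ∷ []} _ (s≤s (s≤s ())) _ _ _ _
    ... | no ¬q = Packs-resp-↭ (prep v (++⁺ʳ _ (↭-trans p (++-comm ys zs))))
      (few fs (+-cancelˡ-≤ 2 4 _ (≤-trans (≤-reflexive (≡-sym (≡-trans (Partition.length-sum P) six))) (+-monoˡ-≤ _ (≤-pred (≰⇒> ¬q)))))
        (All-resp-↭ (↭-trans p (++-comm ys zs)) as) bs pair (≡-trans (≡-sym (↭-length (↭-trans p (++-comm ys zs)))) six))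
      where
      few : ∀ {ys zs ms} → All (Non a) ys → 4 ≤ length ys → All (Adj v) (ys ++ zs) → All (Non v) (a ∷ b ∷ ms) →
        length ms ≡ 2 → length (ys ++ zs) ≡ 6 → Packs Non 2 (v ∷ (ys ++ zs) ++ a ∷ b ∷ ms)
      few {_ ∷ _ ∷ _ ∷ _ ∷ ys} {zs} {_ ∷ _ ∷ []} (p ∷ q ∷ r ∷ s ∷ _) _ as bs refl e with ys ++ zs
      ... | _ ∷ _ ∷ [] = edge4-few as (p ∷ q ∷ r ∷ s ∷ []) bs ab
      few {_ ∷ []} _ (s≤s ()) _ _ _ _
      few {_ ∷ _ ∷ []} _ (s≤s (s≤s ())) _ _ _ _
      few {_ ∷ _ ∷ _ ∷ []} _ (s≤s (s≤s (s≤s ()))) _ _ _ _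

    -- Of the five neighbours of v, three are adjacent to a or three are not; each case has its own
    -- tree.
    five-nonneighbours : ∀ {a ns ms} → All (Adj v) ns → All (Non v) ms → FiveCycle a ms →
      length ns ≡ 5 → Packs Non 2 (v ∷ ns ++ ms)
    five-nonneighbours {a} {ns} {ms} as bs (five-cycle {b} {c} {d} {e} p ab bc cd de ea) five with part (R a) ns
    ... | P@(partition {ys} {zs} q hs fs) with 3 ≤? length ys
    ... | yes h = Packs-resp-↭ (prep v (++⁺ q p)) (many hs h (All-resp-↭ q as) (≡-trans (≡-sym (↭-length q)) five))
      where
      many : ∀ {ys zs} → All (Adj a) ys → 3 ≤ length ys → All (Adj v) (ys ++ zs) →
        length (ys ++ zs) ≡ 5 → Packs Non 2 (v ∷ (ys ++ zs) ++ a ∷ b ∷ c ∷ d ∷ e ∷ [])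
      many {_ ∷ _ ∷ _ ∷ ys} {zs} (x ∷ y ∷ z ∷ _) _ as e with ys ++ zs
      ... | _ ∷ _ ∷ [] = cycle-many as (x ∷ y ∷ z ∷ []) (All-resp-↭ p bs) ab bc cd de ea
      many {_ ∷ []} _ (s≤s ()) _ _
      many {_ ∷ _ ∷ []} _ (s≤s (s≤s ())) _ _
    ... | no ¬h = Packs-resp-↭ (prep v (++⁺ q′ p))
      (few fs (+-cancelˡ-≤ 2 3 _ (≤-trans (≤-reflexive (≡-sym (≡-trans (Partition.length-sum P) five))) (+-monoˡ-≤ _ (≤-pred (≰⇒> ¬h)))))
        (All-resp-↭ q′ as) (≡-trans (≡-sym (↭-length q′)) five))
      where
      q′ = ↭-trans q (++-comm ys zs)
      few : ∀ {ys zs} → All (Non a) ys → 3 ≤ length ys → All (Adj v) (ys ++ zs) →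
        length (ys ++ zs) ≡ 5 → Packs Non 2 (v ∷ (ys ++ zs) ++ a ∷ b ∷ c ∷ d ∷ e ∷ [])
      few {_ ∷ _ ∷ _ ∷ ys} {zs} (x ∷ y ∷ z ∷ _) _ as e with ys ++ zs
      ... | _ ∷ _ ∷ [] = cycle-few as (x ∷ y ∷ z ∷ []) (All-resp-↭ p bs) ab bc cd de ea
      few {_ ∷ []} _ (s≤s ()) _ _
      few {_ ∷ _ ∷ []} _ (s≤s (s≤s ())) _ _

    few-nonneighbours : ∀ {ns} → All (Adj v) ns → 8 ≤ length ns → ∀ ms → Packs Non 2 (v ∷ ns ++ ms)
    few-nonneighbours {ns} as h ms = Packs-resp-↭ (↭-sym (shift v ns ms))
      (Packs-++ (v ∷ ms) (Packs-clique 2 h (neighbours-indep as)))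

    -- An independent triple of nonneighbours forms a quadruple with v, and four neighbours of v form
    -- another one. Without such a triple there are at most five nonneighbours.
    high-degree : ∀ {ns ms} → All (Adj v) ns → All (Non v) ms → 4 ≤ length ns →
                  length ns + length ms ≡ 10 → Packs Non 2 (v ∷ ns ++ ms)
    high-degree {ns} {ms} as bs four len = go ms refl
      where
      with-triple : Contains 3 ms → Packs Non 2 (v ∷ ns ++ ms)
      with-triple t = two-disjoint (Contains-∷ bs t) (Contains-clique 4 four (neighbours-indep as))
        (prep v (++-comm ns ms))

      len-ns : ∀ {k} l → length ms ≡ l → k + l ≡ 10 → length ns ≡ k
      len-ns {k} l e f = +-cancelʳ-≡ l _ k (≡-trans (subst (λ m → length ns + m ≡ 10) e len) (≡-sym f))

      resp : ∀ {ms′} → ms ↭ ms′ → Packs Non 2 (v ∷ ns ++ ms′) → Packs Non 2 (v ∷ ns ++ ms)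
      resp p = Packs-resp-↭ (prep v (++⁺ˡ ns p))

      -- At most two nonneighbours leave eight neighbours, which are two quadruples. Without an
      -- independent triple, three or four nonneighbours span an edge and five form a five-cycle.
      go : ∀ ms′ → ms ≡ ms′ → Packs Non 2 (v ∷ ns ++ ms)
      go [] e = few-nonneighbours as (≤-trans (m≤m+n 8 2) (≤-reflexive (≡-sym (len-ns 0 (cong length e) refl)))) ms
      go (_ ∷ []) e = few-nonneighbours as (≤-trans (m≤m+n 8 1) (≤-reflexive (≡-sym (len-ns 1 (cong length e) refl)))) ms
      go (_ ∷ _ ∷ []) e = few-nonneighbours as (≤-reflexive (≡-sym (len-ns 2 (cong length e) refl))) ms
      go (_ ∷ _ ∷ _ ∷ []) e with edge-or-indep ms
      ... | inj₂ i = with-triple (Contains-clique 3 (≤-reflexive (≡-sym (cong length e))) i)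
      ... | inj₁ (a , b , ys , p , ab) = resp p (three-nonneighbours as (All-resp-↭ p bs) ab
        (len-ns 3 (cong length e) refl) (+-cancelˡ-≡ 2 _ 1 (≡-trans (≡-sym (↭-length p)) (cong length e))))
      go (_ ∷ _ ∷ _ ∷ _ ∷ []) e with edge-or-indep ms
      ... | inj₂ i = with-triple (Contains-clique 3 (≤-trans (m≤m+n 3 1) (≤-reflexive (≡-sym (cong length e)))) i)
      ... | inj₁ (a , b , ys , p , ab) = resp p (four-nonneighbours as (All-resp-↭ p bs) ab
        (len-ns 4 (cong length e) refl) (+-cancelˡ-≡ 2 _ 2 (≡-trans (≡-sym (↭-length p)) (cong length e))))
      go (a ∷ _ ∷ _ ∷ _ ∷ _ ∷ []) refl with five-vertices a refl
      ... | inj₁ t = with-triple t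
      ... | inj₂ c = five-nonneighbours as bs c (len-ns 5 refl refl)
      go (_ ∷ _ ∷ _ ∷ _ ∷ _ ∷ _ ∷ _) refl = with-triple (ramsey₃ (s≤s (s≤s (s≤s (s≤s (s≤s (s≤s z≤n)))))))

  -- Either all degrees are at most three, or a vertex of degree at least four is moved to the front
  -- and its neighbours are separated from its nonneighbours.
  eleven : ∀ {xs} → length xs ≡ 11 → Packs Non 2 xs
  eleven {xs@(s ∷ ys)} len with extract (λ x → 4 ≤ count (R x) xs) (λ x → 4 ≤? count (R x) xs) xs
  ... | inj₂ low = low-degree (suc-injective len) (All.map (λ h → ≤-pred (≰⇒> h)) low)
  ... | inj₁ (v , zs , p , h) with part (R v) zs
  ... | P@(partition q as bs) = Packs-resp-↭ (↭-trans p (prep v q)) (high-degree as bs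
    -- The degree of v is counted in a list containing v itself; `Non-refl` shows that v contributes
    -- nothing.
    (≤-trans h (≤-reflexive (≡-trans (count-↭ (R v) p) (≡-trans (cong (λ b → bit b + count (R v) zs) (Non-refl v)) (≡-sym (Partition.length-yess P))))))
    (≡-trans (Partition.length-sum P) (suc-injective (≡-trans (≡-sym (↭-length p)) len))))

  -- The induction starts from two quadruples in eleven vertices, since for a single one the formula
  -- would give seven while r(3,4) = 9. Each step removes one quadruple.
  quadruples : ∀ k {xs} → (2 + k) * 4 + 3 ≤ length xs → Packs Non (2 + k) xs
  quadruples zero {xs} h = Packs-resp-↭ (↭-reflexive (≡-sym (take++drop≡id 11 xs)))
    (Packs-++ (drop 11 xs) (eleven (≡-trans (length-take 11 xs) (m≤n⇒m⊓n≡m h))))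
  quadruples (suc k) h with ramsey₄ (≤-trans (m≤m+n 9 _) h)
  ... | C@(contains {_ ∷ _ ∷ _ ∷ _ ∷ []} refl i p) =
    pack p i (quadruples k (+-cancelˡ-≤ 4 _ _ (≤-trans h (≤-reflexive (≡-sym (Contains.rest-size C))))))

-- Degree counting: dense triangle-free graphs on 8n vertices are bipartite.

does-true : ∀ {A : Set} (d : Dec A) → does d ≡ true → A
does-true (yes a) _ = a

does-false : ∀ {A : Set} (d : Dec A) → does d ≡ false → ¬ A
does-false (no ¬a) _ = ¬a

All⇒AllPairs : ∀ {A : Set} {P : A → Set} {Q : A → A → Set} → (∀ {x y} → P x → P y → Q x y) →
               ∀ {xs} → All P xs → AllPairs Q xs
All⇒AllPairs f []       = []
All⇒AllPairs f (p ∷ ps) = All.map (f p) ps ∷ All⇒AllPairs f ps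

total : ∀ {V : Set} → (V → V → Bool) → List V → List V → ℕ
total R []       U = 0
total R (v ∷ vs) U = count (R v) U + total R vs U

-- The step of the double count: `total` is defined by rows, one per v, and here a column is split
-- off.
total-∷ : ∀ {V : Set} (R : V → V → Bool) vs u U →
          total R vs (u ∷ U) ≡ count (λ v → R v u) vs + total R vs U
total-∷ R [] u U = refl
total-∷ R (v ∷ vs) u U rewrite total-∷ R vs u U =
  interchange (bit (R v u)) (count (R v) U) (count (λ v → R v u) vs) (total R vs U)
  where
  interchange : ∀ a b c d → (a + b) + (c + d) ≡ (a + c) + (b + d)
  interchange = solve-∀

total-≤ : ∀ {V : Set} (R : V → V → Bool) vs k → (∀ u → count (λ v → R v u) vs ≤ k) →
          ∀ U → total R vs U ≤ length U * k
total-≤ R vs k h []      = ≤-reflexive (empty vs)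
  where
  empty : ∀ vs → total R vs [] ≡ 0
  empty []       = refl
  empty (_ ∷ vs) = empty vs
total-≤ R vs k h (u ∷ U) = ≤-trans (≤-reflexive (total-∷ R vs u U)) (+-mono-≤ (h u) (total-≤ R vs k h U))

count-witness : ∀ {V : Set} (p : V → Bool) xs → 1 ≤ count p xs → ∃ λ x → x ∈ᴸ xs × p x ≡ true
count-witness p (x ∷ xs) h with p x in eq
... | true  = x , here refl , eq
... | false with count-witness p xs h
... | y , y∈ , e = y , there y∈ , e

module Bipartition {n m : ℕ} (4≤n : 4 ≤ n) (m≡8n : m ≡ 8 * n) (R : Fin m → Fin m → Bool)
  (R-sym : ∀ x y → R x y ≡ R y x)
  (no-triangle : ∀ {x y z} → R x y ≡ true → R y z ≡ true → R x z ≡ true → ⊥)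
  (dense : ∀ v → 4 * n ≤ 3 + count (R v) (allFin m)) where
  open TriangleFree R R-sym no-triangle

  U : List (Fin m)
  U = allFin m

  length-U : length U ≡ 8 * n
  length-U = ≡-trans (length-tabulate id) m≡8n

  dense-total : ∀ vs → length vs * (4 * n) ≤ length vs * 3 + total R vs U
  dense-total [] = z≤n
  dense-total (v ∷ vs) = ≤-trans (+-mono-≤ (dense v) (dense-total vs))
    (≤-reflexive (interchange (count (R v) U) (length vs * 3) (total R vs U)))
    where
    interchange : ∀ a b c → (3 + a) + (b + c) ≡ (3 + b) + (a + c)
    interchange = solve-∀

  -- The five vertices may coincide: the count runs over a list with repetitions and uses only that
  -- consecutive entries are adjacent.
  no-closed-5-walk : ∀ {a b c d e} → Adj a b → Adj b c → Adj c d → Adj d e → Adj e a → ⊥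
  no-closed-5-walk {a} {b} {c} {d} {e} ab bc cd de ea =
    -- Counting gives 20n ≤ 16n + 15, contrary to 4n ≥ 16.
    <⇒≱ (+-monoʳ-< (16 * n) (≤-trans (s≤s ≤-refl) (*-monoʳ-≤ 4 4≤n))) (begin
      16 * n + 4 * n            ≡⟨ eq₁ n ⟩
      5 * (4 * n)               ≤⟨ dense-total vs ⟩
      15 + total R vs U         ≤⟨ +-monoʳ-≤ 15 (total-≤ R vs 2 at-most-two U) ⟩
      15 + length U * 2         ≡⟨ cong (λ l → 15 + l * 2) length-U ⟩
      15 + 8 * n * 2            ≡⟨ eq₂ n ⟩
      16 * n + 15               ∎)
    where
    open ≤-Reasoning
    vs = a ∷ b ∷ c ∷ d ∷ e ∷ []
    eq₁ : ∀ n → 16 * n + 4 * n ≡ 5 * (4 * n)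
    eq₁ = solve-∀
    eq₂ : ∀ n → 15 + 8 * n * 2 ≡ 16 * n + 15
    eq₂ = solve-∀
    -- Consecutive entries of the walk have no common neighbour, so the neighbours of u occupy
    -- nonconsecutive places on a cycle of length five.
    at-most-two : ∀ u → count (λ v → R v u) vs ≤ 2
    at-most-two u with R a u in au | R b u in bu | R c u in cu | R d u in du | R e u in eu
    ... | true  | true  | _     | _     | _     = ⊥-elim (no-triangle ab bu au)
    ... | true  | _     | _     | _     | true  = ⊥-elim (no-triangle ea au eu)
    ... | _     | true  | true  | _     | _     = ⊥-elim (no-triangle bc cu bu)
    ... | _     | _     | true  | true  | _     = ⊥-elim (no-triangle cd du cu)
    ... | _     | _     | _     | true  | true  = ⊥-elim (no-triangle de eu du)
    ... | true  | false | true  | false | false = ≤-refl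
    ... | true  | false | false | true  | false = ≤-refl
    ... | true  | false | false | false | false = s≤s z≤n
    ... | false | true  | false | true  | false = ≤-refl
    ... | false | true  | false | false | true  = ≤-refl
    ... | false | true  | false | false | false = s≤s z≤n
    ... | false | false | true  | false | true  = ≤-refl
    ... | false | false | true  | false | false = s≤s z≤n
    ... | false | false | false | true  | false = s≤s z≤n
    ... | false | false | false | false | true  = s≤s z≤n
    ... | false | false | false | false | false = z≤n

  -- A walk of length two; the vertices reached in this way will be the side of v.
  Walk : Fin m → Fin m → Set
  Walk v x = ∃ λ y → Adj v y × Adj x y

  walk? : ∀ v x → Dec (Walk v x)
  walk? v x = Fin.any? (λ y → (R v y Bool.≟ true) ×-dec (R x y Bool.≟ true))

  walks-nonadjacent : ∀ {v x x′} → Walk v x → Walk v x′ → Non x x′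
  walks-nonadjacent {v} {x} {x′} (y , vy , xy) (y′ , vy′ , xy′) with R x x′ in eq
  ... | false = refl
  ... | true  = ⊥-elim (no-closed-5-walk eq xy′ (Adj-sym vy′) vy (Adj-sym xy))

  -- The neighbourhoods of u, v and x would be pairwise disjoint, those of u and v because uv lies
  -- in no triangle. Then 3(4n - 3) ≤ 8n, so 4n ≤ 9, contrary to 4n ≥ 16.
  no-three-neighbourhoods : ∀ {u v x} → Adj u v → ¬ Walk v x → ¬ Walk u x → ⊥
  no-three-neighbourhoods {u} {v} {x} uv ¬vx ¬ux =
    <⇒≱ (+-monoʳ-< (8 * n) (≤-trans (m≤m+n 10 6) (*-monoʳ-≤ 4 4≤n))) (begin
      8 * n + 4 * n            ≡⟨ eq₁ n ⟩
      3 * (4 * n)               ≤⟨ dense-total vs ⟩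
      9 + total R vs U         ≤⟨ +-monoʳ-≤ 9 (total-≤ R vs 1 at-most-one U) ⟩
      9 + length U * 1         ≡⟨ cong (λ l → 9 + l * 1) length-U ⟩
      9 + 8 * n * 1            ≡⟨ eq₂ n ⟩
      8 * n + 9               ∎)
    where
    open ≤-Reasoning
    vs = u ∷ v ∷ x ∷ []
    eq₁ : ∀ n → 8 * n + 4 * n ≡ 3 * (4 * n)
    eq₁ = solve-∀
    eq₂ : ∀ n → 9 + 8 * n * 1 ≡ 8 * n + 9
    eq₂ = solve-∀
    at-most-one : ∀ y → count (λ v → R v y) vs ≤ 1
    at-most-one y with R u y in uy | R v y in vy | R x y in xy
    ... | true  | true  | _     = ⊥-elim (no-triangle uv vy uy)
    ... | true  | _     | true  = ⊥-elim (¬ux (y , uy , xy))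
    ... | _     | true  | true  = ⊥-elim (¬vx (y , vy , xy))
    ... | true  | false | false = ≤-refl
    ... | false | true  | false = ≤-refl
    ... | false | false | true  = ≤-refl
    ... | false | false | false = z≤n

  -- One side consists of the vertices reached from v by walks of length two. All others are reached
  -- in this way from a neighbour u of v, and two adjacent vertices of one side would close a walk
  -- of length five.
  bipartition : Fin m → ∃₂ λ A B → U ↭ A ++ B × Indep A × Indep B
  bipartition v with count-witness (R v) U (+-cancelˡ-≤ 3 1 _ (≤-trans (≤-trans (m≤m+n 4 12) (*-monoʳ-≤ 4 4≤n)) (dense v)))
  ... | u , _ , vu with part (λ x → does (walk? v x)) U
  ... | partition {A} {B} p ws ns = A , B , p ,
    All⇒AllPairs walks-nonadjacent (All.map (λ {x} → does-true (walk? v x)) ws) ,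
    All⇒AllPairs walks-nonadjacent (All.map (λ {x} e → other-side x (does-false (walk? v x) e)) ns)
    where
    other-side : ∀ x → ¬ Walk v x → Walk u x
    other-side x ¬w with walk? u x
    ... | yes w = w
    ... | no ¬w′ = ⊥-elim (no-three-neighbourhoods (Adj-sym vu) ¬w ¬w′)

-- From packed quadruples to monochromatic copies.

module _ {V : Set} where

  Unique-resp-↭ : ∀ {xs ys : List V} → xs ↭ ys → Unique xs → Unique ys
  Unique-resp-↭ p = Permₛ.Unique-resp-↭ (setoid V) (↭⇒↭ₛ p)

  lookup-pairs : ∀ {P : V → V → Set} → Symmetric P → ∀ {xs} → AllPairs P xs →
                 ∀ i j → i ≢ j → P (lookup xs i) (lookup xs j)
  lookup-pairs P-sym (_ ∷ _) zero zero i≢j = ⊥-elim (i≢j refl)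
  lookup-pairs P-sym (p ∷ _) zero (suc j) _ = All.lookup p (∈-lookup j)
  lookup-pairs P-sym (p ∷ _) (suc i) zero _ = P-sym (All.lookup p (∈-lookup i))
  lookup-pairs P-sym (_ ∷ ps) (suc i) (suc j) i≢j = lookup-pairs P-sym ps i j (i≢j ∘ cong suc)

  module _ {P : V → V → Set} where

    quad : ∀ {n xs} → Packs P n xs → Fin n → Fin 4 → V
    quad (pack {a = a} {b} {c} {d} _ _ _) zero = lookup (a ∷ b ∷ c ∷ d ∷ [])
    quad (pack _ _ r) (suc i) = quad r i

    quad-∈ : ∀ {n xs} (r : Packs P n xs) i x → quad r i x ∈ᴸ xs
    quad-∈ (pack {ys = ys} p _ _) zero x = ∈-resp-↭ (↭-sym p) (∈-++⁺ˡ {ys = ys} (∈-lookup x))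
    quad-∈ (pack {a = a} {b} {c} {d} p _ r) (suc i) x =
      ∈-resp-↭ (↭-sym p) (∈-++⁺ʳ (a ∷ b ∷ c ∷ d ∷ []) (quad-∈ r i x))

    quad-pairs : Symmetric P → ∀ {n xs} (r : Packs P n xs) i {x y} → x ≢ y → P (quad r i x) (quad r i y)
    quad-pairs P-sym (pack _ c _) zero x≢y = lookup-pairs P-sym c _ _ x≢y
    quad-pairs P-sym (pack _ _ r) (suc i) x≢y = quad-pairs P-sym r i x≢y

    -- As `xs` has no repetitions, the permutation in each `pack` separates its quadruple from all
    -- later ones.
    quad-injective : ∀ {n xs} (r : Packs P n xs) → Unique xs →
                     ∀ i x j y → quad r i x ≡ quad r j y → (i , x) ≡ (j , y)
    quad-injective (pack {a = a} {b} {c} {d} {ys} p q r) u i x j y e =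
      go (Unique-resp-↭ p u) i j e
      where
      abcd = a ∷ b ∷ c ∷ d ∷ []
      disjoint : Unique (abcd ++ ys) → ∀ x {z} → z ∈ᴸ ys → lookup abcd x ≢ z
      disjoint (ua ∷ _) zero z = All.lookup ua (there (there (there z)))
      disjoint (_ ∷ ub ∷ _) (suc zero) z = All.lookup ub (there (there z))
      disjoint (_ ∷ _ ∷ uc ∷ _) (suc (suc zero)) z = All.lookup uc (there z)
      disjoint (_ ∷ _ ∷ _ ∷ ud ∷ _) (suc (suc (suc zero))) z = All.lookup ud z
      first : Unique (abcd ++ ys) → Unique abcd
      first u = AllPairs.take⁺ 4 u
      go : Unique (abcd ++ ys) → ∀ i j → quad (pack p q r) i x ≡ quad (pack p q r) j y → (i , x) ≡ (j , y)
      go u zero zero e with x Fin.≟ y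
      ... | yes refl = refl
      ... | no x≢y = ⊥-elim (lookup-pairs ≢-sym (first u) x y x≢y e)
      go u zero (suc j) e = ⊥-elim (disjoint u x (quad-∈ r j y) e)
      go u (suc i) zero e = ⊥-elim (disjoint u y (quad-∈ r i x) (≡-sym e))
      go (_ ∷ _ ∷ _ ∷ _ ∷ u) (suc i) (suc j) e with quad-injective r u i x j y e
      ... | refl = refl

module Host (H : Graph) (E-sym : Symmetric (E H)) (E-irr : ∀ {v} → ¬ E H v v) (c : Colouring H) where

  Coloured : Bool → Graph.V H → Graph.V H → Set
  Coloured b u v = E H u v × col c u v ≡ b

  Coloured-sym : ∀ {b} → Symmetric (Coloured b)
  Coloured-sym (e , q) = E-sym e , ≡-trans (Colouring.sym c _ _) q

  Coloured-≢ : ∀ {b u v} → Coloured b u v → u ≢ v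
  Coloured-≢ (e , _) refl = E-irr e

  triangle-copy : ∀ {b x y z} → Coloured b x y → Coloured b y z → Coloured b x z → MonoCopy H c b (K 3)
  triangle-copy {b} {x} {y} {z} xy yz xz =
    lookup (x ∷ y ∷ z ∷ []) , injective , λ i j → edges i j
    where
    edges : ∀ i j → i ≢ j → Coloured b (lookup (x ∷ y ∷ z ∷ []) i) (lookup (x ∷ y ∷ z ∷ []) j)
    edges = lookup-pairs {P = Coloured b} Coloured-sym ((xy ∷ xz ∷ []) ∷ (yz ∷ []) ∷ [] ∷ [])
    injective : ∀ {i j} → lookup (x ∷ y ∷ z ∷ []) i ≡ lookup (x ∷ y ∷ z ∷ []) j → i ≡ j
    injective {i} {j} e with i Fin.≟ j
    ... | yes i≡j = i≡j
    ... | no i≢j  = ⊥-elim (Coloured-≢ (edges i j i≢j) e)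

  -- The packing may live in another type than the host: `f` is `suc` for blades among the old
  -- vertices and `id` for a blade with an extra vertex. `f-blue` asks for distinct vertices because
  -- `Non` holds between equal ones.
  fan : ∀ {n} {W : Set} {P : W → W → Set} (f : W → Graph.V H) → Injective _≡_ _≡_ f →
        (∀ {x y} → x ≢ y → P x y → Coloured false (f x) (f y)) → Symmetric P →
        ∀ {z xs} → Unique xs → All (λ x → Coloured false z (f x)) xs → Packs P n xs →
        MonoCopy H c false (F 4 n)
  fan {n} f f-inj f-blue P-sym {z} {xs} u centre r = g , g-inj , edges
    where
    spoke : ∀ i x → Coloured false z (f (quad r i x))
    spoke i x = All.lookup centre (quad-∈ r i x)
    g : Graph.V (F 4 n) → Graph.V H
    g nothing        = z
    g (just (i , x)) = f (quad r i x)
    g-inj : Injective _≡_ _≡_ g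
    g-inj {nothing} {nothing} _ = refl
    g-inj {nothing} {just (i , x)} e = ⊥-elim (Coloured-≢ (spoke i x) e)
    g-inj {just (i , x)} {nothing} e = ⊥-elim (Coloured-≢ (spoke i x) (≡-sym e))
    g-inj {just (i , x)} {just (j , y)} e = cong just (quad-injective r u i x j y (f-inj e))
    edges : ∀ s t → E (F 4 n) s t → Coloured false (g s) (g t)
    edges nothing (just (i , x)) _ = spoke i x
    edges (just (i , x)) nothing _ = Coloured-sym (spoke i x)
    edges (just (i , x)) (just (.i , y)) (refl , x≢y) =
      f-blue (λ e → x≢y (cong proj₂ (quad-injective r u i x i y e))) (quad-pairs P-sym r i x≢y)

  -- The centre is a, one blade consists of z, b, d, e, and the other k blades are cut from `xs`.
  clique-with-vertex : ∀ {k z a b d e xs} → All (z ≢_) xs → AllPairs (Coloured false) (a ∷ b ∷ d ∷ e ∷ xs) →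
    All (Coloured false z) (a ∷ b ∷ d ∷ e ∷ []) → k * 4 ≤ length xs → MonoCopy H c false (F 4 (suc k))
  clique-with-vertex {k} {z} {a} {b} {d} {e} z∉ (ha ∷ hb@(bd ∷ be ∷ bxs) ∷ hd@(de ∷ dxs) ∷ he ∷ hxs)
    (za ∷ zs@(zb ∷ zd ∷ ze ∷ [])) h =
    fan id id (λ _ p → p) Coloured-sym
      ((Coloured-≢ zb ∷ Coloured-≢ zd ∷ Coloured-≢ ze ∷ z∉) ∷
        AllPairs.map Coloured-≢ (hb ∷ hd ∷ he ∷ hxs))
      (Coloured-sym za ∷ ha)
      (pack {a = z} {b} {d} {e} ↭-refl (zs ∷ (bd ∷ be ∷ []) ∷ (de ∷ []) ∷ [] ∷ [])
        (Packs-clique k h hxs))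

AllPairs-prefix : ∀ {A : Set} {Q : A → A → Set} xs {ys} → AllPairs Q (xs ++ ys) → AllPairs Q xs
AllPairs-prefix []       _        = []
AllPairs-prefix (x ∷ xs) (q ∷ qs) = All.++⁻ˡ xs q ∷ AllPairs-prefix xs qs

AllPairs-cross : ∀ {A : Set} {Q : A → A → Set} xs {ys} → AllPairs Q (xs ++ ys) → All (λ x → All (Q x) ys) xs
AllPairs-cross []       _        = []
AllPairs-cross (x ∷ xs) (q ∷ qs) = All.++⁻ʳ xs q ∷ AllPairs-cross xs qs

count-≤-length : ∀ {A : Set} (p : A → Bool) xs → count p xs ≤ length xs
count-≤-length p [] = z≤n
count-≤-length p (x ∷ xs) with p x
... | true  = s≤s (count-≤-length p xs)
... | false = m≤n⇒m≤1+n (count-≤-length p xs)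

count-∧ : ∀ {A : Set} (p q : A → Bool) xs →
          count (λ x → p x ∧ not (q x)) xs + count (λ x → p x ∧ q x) xs ≡ count p xs
count-∧ p q [] = refl
count-∧ p q (x ∷ xs) with p x | q x
... | false | _ = count-∧ p q xs
... | true | false = cong suc (count-∧ p q xs)
... | true | true = ≡-trans (+-suc _ _) (cong suc (count-∧ p q xs))

∣∣-count : ∀ {m} {A : Set} (S : Subset m) (f : Fin m → A) (p : A → Bool) →
           (∀ i → p (f i) ≡ Vec.lookup S i) → count p (tabulate f) ≡ ∣ S ∣
∣∣-count Vec.[] f p h = refl
∣∣-count (s Vec.∷ S) f p h rewrite h zero with s
... | true  = cong suc (∣∣-count S (f ∘ suc) p (h ∘ suc))
... | false = ∣∣-count S (f ∘ suc) p (h ∘ suc)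

∧-true : ∀ {a b} → a ∧ b ≡ true → a ≡ true × b ≡ true
∧-true {true} {true} _ = refl , refl

not-true : ∀ {a} → not a ≡ true → a ≡ false
not-true {false} _ = refl

StarE-sym : ∀ {m} {S : Subset m} → Symmetric (StarE m S)
StarE-sym {x = zero}  {suc j} e = e
StarE-sym {x = suc i} {zero}  e = e
StarE-sym {x = suc i} {suc j} e = ≢-sym e

StarE-irr : ∀ {m} {S : Subset m} {v} → ¬ StarE m S v v
StarE-irr {v = suc i} e = e refl

-- Upper bounds.

-- The number of old vertices is a variable with an equation, because `8 * n + 1 ∸ 1` does not
-- reduce to `8 * n`.
module Upper {n m : ℕ} (4≤n : 4 ≤ n) (m≡8n : m ≡ 8 * n) (S : Subset m) (∣S∣ : ∣ S ∣ ≡ 4 * n + 4)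
  (c : Colouring (KStar m S)) where
  H = KStar m S
  open Host H StarE-sym StarE-irr c
  Copy = MonoCopy H c false (F 4 n)

  -- A colouring is arbitrary on the diagonal, so loops are removed explicitly.
  R : Fin m → Fin m → Bool
  R i j = not (does (i Fin.≟ j)) ∧ col c (suc i) (suc j)

  R-true : ∀ {i j} → R i j ≡ true → Coloured true (suc i) (suc j)
  R-true {i} {j} e with i Fin.≟ j
  ... | no i≢j = i≢j , e

  R-false : ∀ {i j} → i ≢ j → R i j ≡ false → Coloured false (suc i) (suc j)
  R-false {i} {j} i≢j e with i Fin.≟ j
  ... | yes i≡j = ⊥-elim (i≢j i≡j)
  ... | no _    = i≢j , e

  R-sym : ∀ i j → R i j ≡ R j i
  R-sym i j with i Fin.≟ j | j Fin.≟ i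
  ... | yes _ | yes _ = refl
  ... | no _  | no _  = Colouring.sym c (suc i) (suc j)
  ... | yes p | no q  = ⊥-elim (q (≡-sym p))
  ... | no p  | yes q = ⊥-elim (p (≡-sym q))

  module _ (no-red : ∀ {x y z} → Coloured true x y → Coloured true y z → Coloured true x z → ⊥) where
    no-triangle : ∀ {x y z} → R x y ≡ true → R y z ≡ true → R x z ≡ true → ⊥
    no-triangle xy yz xz = no-red (R-true xy) (R-true yz) (R-true xz)

    open TriangleFree R R-sym no-triangle

    fan-at : ∀ {v xs} → Unique (v ∷ xs) → All (Non v) xs → Packs Non n xs → Copy
    fan-at (v∉ ∷ u) vs r = fan suc Fin.suc-injective R-false Non-sym u
      (All.zipWith (λ { (q , e) → R-false q e }) (v∉ , vs)) r

    clique-fan : ∀ {xs} → Unique xs → Indep xs → n * 4 < length xs → Copy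
    clique-fan {x ∷ xs} u (h ∷ i) (s≤s l) = fan-at u h (Packs-clique n l i)

    U = allFin m

    length-U : length U ≡ 8 * n
    length-U = ≡-trans (length-tabulate id) m≡8n

    n-quadruples : ∀ {xs} → n * 4 + 3 ≤ length xs → Packs Non n xs
    n-quadruples h = go 4≤n h
      where
      go : ∀ {n xs} → 4 ≤ n → n * 4 + 3 ≤ length xs → Packs Non n xs
      go {suc (suc k)} _ h = quadruples k h
      go {suc zero} (s≤s ()) _

    -- With red degree at most 4n - 4, at least 8n - 1 - (4n - 4) = 4n + 3 old vertices are blue
    -- neighbours of v, enough for n disjoint blue quadruples.
    sparse-fan : ∀ v → 4 + count (R v) U ≤ 4 * n → Copy
    sparse-fan v h with ∈-∃++ (∈-allFin v)
    ... | ys , zs , e with part (R v) (ys ++ zs)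
    ... | P@(partition {as} {bs} p _ fs) = fan-at
      (AllPairs-prefix (v ∷ bs) (Unique-resp-↭ (↭-trans to-front (prep v (↭-trans p (++-comm as bs)))) (allFin⁺ m)))
      fs (n-quadruples enough)
      where
      to-front : U ↭ v ∷ ys ++ zs
      to-front = ↭-trans (↭-reflexive e) (shift v ys zs)
      few : 4 + length as ≤ 4 * n
      few = ≤-trans (+-monoʳ-≤ 4 (≤-trans (≤-reflexive (Partition.length-yess P))
        (≤-trans (m≤n+m _ (bit (R v v))) (≤-reflexive (≡-sym (count-↭ (R v) to-front)))))) h
      enough : n * 4 + 3 ≤ length bs
      enough = +-cancelʳ-≤ (suc (length as)) _ _ (begin
        n * 4 + 3 + suc (length as)  ≡⟨ eq₁ n (length as) ⟩
        4 * n + (4 + length as)      ≤⟨ +-monoʳ-≤ (4 * n) few ⟩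
        4 * n + 4 * n                ≡⟨ eq₂ n ⟩
        8 * n                        ≡⟨ ≡-sym length-U ⟩
        length U                     ≡⟨ ↭-length to-front ⟩
        suc (length (ys ++ zs))      ≡⟨ cong suc (≡-sym (Partition.length-sum P)) ⟩
        suc (length as + length bs)  ≡⟨ +-comm (suc (length as)) (length bs) ⟩
        length bs + suc (length as)  ∎)
        where
        open ≤-Reasoning
        eq₁ : ∀ n a → n * 4 + 3 + suc a ≡ 4 * n + (4 + a)
        eq₁ = solve-∀
        eq₂ : ∀ n → 4 * n + 4 * n ≡ 8 * n
        eq₂ = solve-∀

    -- Serves two cases: z is the new vertex and `p` selects its blue neighbours, or z is an old
    -- vertex outside `X` and `p` selects red neighbours of the new vertex.
    extra-vertex : ∀ {z X} (p : Fin m → Bool) → Unique X → Indep X → n * 4 ≤ length X → 4 ≤ count p X →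
      All (λ i → z ≢ suc i × (p i ≡ true → Coloured false z (suc i))) X → Copy
    extra-vertex {z} {X} p u i l h zs with part p X
    ... | P@(partition {a ∷ b ∷ d ∷ e ∷ ys} {ns} q (pa ∷ pb ∷ pd ∷ pe ∷ _) _) =
      go 4≤n l
      where
      X′ = a ∷ b ∷ d ∷ e ∷ ys ++ ns
      blue : AllPairs (λ i j → Coloured false (suc i) (suc j)) X′
      blue = AllPairs.zipWith (λ { (x , y) → R-false x y }) (Unique-resp-↭ q u , AllPairs-resp-↭ Non-sym q i)
        where
        AllPairs-resp-↭ : ∀ {Q : Fin m → Fin m → Set} → Symmetric Q → ∀ {xs ys} → xs ↭ ys → AllPairs Q xs → AllPairs Q ys
        AllPairs-resp-↭ {Q} Q-sym p = Permₛ.AllPairs-resp-↭ (setoid _) Q-sym (resp₂ Q) (↭⇒↭ₛ p)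
      zs′ : All (λ i → z ≢ suc i × (p i ≡ true → Coloured false z (suc i))) X′
      zs′ = All-resp-↭ q zs
      go : ∀ {n} → 4 ≤ n → n * 4 ≤ length X → MonoCopy H c false (F 4 n)
      go {suc k} _ l with zs′
      ... | (_ , za) ∷ (_ , zb) ∷ (_ , zd) ∷ (_ , ze) ∷ z∉ =
        clique-with-vertex (All.map⁺ (All.map proj₁ z∉)) (AllPairs.map⁺ blue)
          (za pa ∷ zb pb ∷ zd pd ∷ ze pe ∷ [])
          (≤-trans (+-cancelˡ-≤ 4 _ _ (≤-trans l (≤-reflexive (↭-length q)))) (≤-reflexive (≡-sym (length-map suc (ys ++ ns)))))
    extra-vertex _ _ _ _ h _ | P@(partition {[]} _ _ _) with () ← ≤-trans h (≤-reflexive (≡-sym (Partition.length-yess P)))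
    extra-vertex _ _ _ _ h _ | P@(partition {_ ∷ []} _ _ _) with s≤s () ← ≤-trans h (≤-reflexive (≡-sym (Partition.length-yess P)))
    extra-vertex _ _ _ _ h _ | P@(partition {_ ∷ _ ∷ []} _ _ _) with s≤s (s≤s ()) ← ≤-trans h (≤-reflexive (≡-sym (Partition.length-yess P)))
    extra-vertex _ _ _ _ h _ | P@(partition {_ ∷ _ ∷ _ ∷ []} _ _ _) with s≤s (s≤s (s≤s ())) ← ≤-trans h (≤-reflexive (≡-sym (Partition.length-yess P)))

    joined blue-to-v red-to-v : Fin m → Bool
    joined i     = Vec.lookup S i
    blue-to-v i = joined i ∧ not (col c zero (suc i))
    red-to-v i  = joined i ∧ col c zero (suc i)

    blue-to-v-true : ∀ {i} → blue-to-v i ≡ true → Coloured false zero (suc i)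
    blue-to-v-true {i} e with ∧-true {joined i} e
    ... | s , q = lookup⇒[]= i S s , not-true q

    red-to-v-true : ∀ {i} → red-to-v i ≡ true → Coloured true zero (suc i)
    red-to-v-true {i} e with ∧-true {joined i} e
    ... | s , q = lookup⇒[]= i S s , q

    fan-from-blue : ∀ {X} → Unique X → Indep X → n * 4 ≤ length X → 4 ≤ count blue-to-v X → Copy
    fan-from-blue u i l h = extra-vertex blue-to-v u i l h (All.universal (λ _ → (λ ()) , blue-to-v-true) _)

    -- A red edge from y to a red neighbour of the new vertex would close a red triangle, so y is
    -- joined in blue to at least four vertices of the blue clique `X`.
    fan-from-red : ∀ X Y → Unique (X ++ Y) → Unique X → Indep X → n * 4 ≤ length X →
              4 ≤ count red-to-v X → 1 ≤ count red-to-v Y → Copy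
    fan-from-red X Y uXY u i l h g with count-witness red-to-v Y g
    ... | y , y∈ , e = extra-vertex red-to-v u i l h (All.map neighbour (AllPairs-cross X uXY))
      where
      neighbour : ∀ {x} → All (x ≢_) Y → suc y ≢ suc x × (red-to-v x ≡ true → Coloured false (suc y) (suc x))
      neighbour {x} x∉ = (λ s → x≢y (≡-sym (Fin.suc-injective s))) , λ r → R-false (≢-sym x≢y) (blue r)
        where
        x≢y : x ≢ y
        x≢y = All.lookup x∉ y∈
        blue : red-to-v x ≡ true → Non y x
        blue r with R y x in q
        ... | false = refl
        ... | true  = ⊥-elim (no-red (red-to-v-true e) (R-true q) (red-to-v-true r))

    joined-total : ∀ A B → U ↭ A ++ B →
      (count blue-to-v A + count red-to-v A) + (count blue-to-v B + count red-to-v B) ≡ 4 * n + 4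
    joined-total A B p = ≡-trans
      (cong₂ _+_ (count-∧ joined (λ i → col c zero (suc i)) A) (count-∧ joined (λ i → col c zero (suc i)) B))
      (≡-trans (≡-sym (count-++ joined A B)) (≡-trans (≡-sym (count-↭ joined p))
        (≡-trans (∣∣-count S id joined (λ _ → refl)) ∣S∣)))

    -- At most 4n of the 4n + 4 edges at the new vertex go to `A`, so at least four go to `B`, and
    -- at most three of these are blue.
    some-red : ∀ A B → U ↭ A ++ B → length A ≤ n * 4 → count blue-to-v B ≤ 3 → 1 ≤ count red-to-v B
    some-red A B p hA b = +-cancelˡ-≤ (4 * n + 3) _ _ (begin
      4 * n + 3 + 1                        ≡⟨ +-assoc (4 * n) 3 1 ⟩
      4 * n + 4                            ≡⟨ ≡-sym (joined-total A B p) ⟩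
      (count blue-to-v A + count red-to-v A) + (count blue-to-v B + count red-to-v B)
        ≤⟨ +-mono-≤ (≤-trans (≤-reflexive (count-∧ joined _ A)) (≤-trans (count-≤-length joined A) (≤-trans hA (≤-reflexive (*-comm n 4)))))
                    (+-monoˡ-≤ _ b) ⟩
      4 * n + (3 + count red-to-v B)       ≡⟨ ≡-sym (+-assoc (4 * n) 3 _) ⟩
      4 * n + 3 + count red-to-v B         ∎)
      where open ≤-Reasoning

    balanced : ∀ {A B} → U ↭ A ++ B → Indep A → Indep B → n * 4 ≤ length A → n * 4 ≤ length B →
               length A ≤ n * 4 → length B ≤ n * 4 → Copy
    balanced {A} {B} p iA iB lA lB hA hB
      with 4 ≤? count blue-to-v A | 4 ≤? count blue-to-v B | 4 ≤? count red-to-v A | 4 ≤? count red-to-v B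
    ... | yes h | _ | _ | _ = fan-from-blue uA iA lA h
      where uA = AllPairs-prefix A (Unique-resp-↭ p (allFin⁺ m))
    ... | _ | yes h | _ | _ = fan-from-blue uB iB lB h
      where uB = AllPairs-prefix B (Unique-resp-↭ (↭-trans p (++-comm A B)) (allFin⁺ m))
    ... | _ | no b | yes h | _ = fan-from-red A B u (AllPairs-prefix A u) iA lA h (some-red A B p hA (≤-pred (≰⇒> b)))
      where u = Unique-resp-↭ p (allFin⁺ m)
    ... | no b | _ | _ | yes h = fan-from-red B A u (AllPairs-prefix B u) iB lB h (some-red B A p′ hB (≤-pred (≰⇒> b)))
      where
      p′ = ↭-trans p (++-comm A B)
      u = Unique-resp-↭ p′ (allFin⁺ m)
    -- With at most three edges of each colour to each side, the new vertex would have at most 12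
    -- edges, but it has 4n + 4 ≥ 20.
    ... | no a | no b | no r | no s = ⊥-elim (<⇒≱ (s≤s (m≤m+n 12 7)) (begin
      20                                   ≤⟨ +-monoˡ-≤ 4 (*-monoʳ-≤ 4 4≤n) ⟩
      4 * n + 4                            ≡⟨ ≡-sym (joined-total A B p) ⟩
      (count blue-to-v A + count red-to-v A) + (count blue-to-v B + count red-to-v B)
        ≤⟨ +-mono-≤ (+-mono-≤ (≤-pred (≰⇒> a)) (≤-pred (≰⇒> r))) (+-mono-≤ (≤-pred (≰⇒> b)) (≤-pred (≰⇒> s))) ⟩
      12                                   ∎))
      where open ≤-Reasoning

    -- A side with more than 4n vertices is a blue clique large enough for the whole fan; otherwise
    -- both sides have exactly 4n vertices, as they sum to 8n.
    bipartite-copy : ∀ {A B} → U ↭ A ++ B → Indep A → Indep B → Copy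
    bipartite-copy {A} {B} p iA iB with length A ≤? n * 4 | length B ≤? n * 4
    ... | no h | _ = clique-fan (AllPairs-prefix A (Unique-resp-↭ p (allFin⁺ m))) iA (≰⇒> h)
    ... | _ | no h = clique-fan (AllPairs-prefix B (Unique-resp-↭ (↭-trans p (++-comm A B)) (allFin⁺ m))) iB (≰⇒> h)
    ... | yes hA | yes hB = balanced p iA iB
      (+-cancelʳ-≤ (n * 4) _ _ (≤-trans (≤-reflexive sizes) (+-monoʳ-≤ (length A) hB)))
      (+-cancelˡ-≤ (n * 4) _ _ (≤-trans (≤-reflexive sizes) (+-monoˡ-≤ (length B) hA))) hA hB
      where
      double : ∀ n → n * 4 + n * 4 ≡ 8 * n
      double = solve-∀
      sizes : n * 4 + n * 4 ≡ length A + length B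
      sizes = ≡-trans (double n) (≡-trans (≡-sym length-U) (≡-trans (↭-length p) (length-++ A)))

    blue-copy : Copy
    blue-copy with Fin.all? (λ v → 4 * n ≤? 3 + count (R v) U)
    ... | yes dense with Bipartition.bipartition 4≤n m≡8n R R-sym no-triangle dense vertex
      where
      vertex : Fin m
      vertex = subst Fin (≡-sym m≡8n) (fromℕ< {0} (≤-trans (s≤s z≤n) (*-monoʳ-≤ 8 4≤n)))
    ... | A , B , p , iA , iB = bipartite-copy p iA iB
    blue-copy | no ¬dense with Fin.¬∀⟶∃¬ m _ (λ v → 4 * n ≤? 3 + count (R v) U) ¬dense
    ... | v , h = sparse-fan v (≰⇒> h)

  coloured? : ∀ b x y → Dec (Coloured b x y)
  coloured? b x y = E? x y ×-dec (col c x y Bool.≟ b)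
    where
    E? : ∀ x y → Dec (StarE m S x y)
    E? zero zero = no λ ()
    E? zero (suc j) = j ∈? S
    E? (suc i) zero = i ∈? S
    E? (suc i) (suc j) = ¬? (i Fin.≟ j)

  arrows : MonoCopy H c true (K 3) ⊎ Copy
  arrows with Fin.any? (λ x → Fin.any? (λ y → Fin.any? (λ z →
    coloured? true x y ×-dec coloured? true y z ×-dec coloured? true x z)))
  ... | yes (_ , _ , _ , xy , yz , xz) = inj₁ (triangle-copy xy yz xz)
  ... | no ¬t = inj₂ (blue-copy (λ xy yz xz → ¬t (_ , _ , _ , xy , yz , xz)))

-- Lower bounds.

-- Pigeonhole principle, after subtracting `lo`.
interval-size : ∀ {k w} lo (h : Fin k → ℕ) → Injective _≡_ _≡_ h → (∀ i → lo ≤ h i × h i < lo + w) → k ≤ w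
interval-size {k} {w} lo h h-inj bounds = Fin.injective⇒≤ {f = g} g-inj
  where
  g-< : ∀ i → h i ∸ lo < w
  g-< i = +-cancelˡ-< lo _ _ (subst (_< lo + w) (≡-sym (m+[n∸m]≡n (proj₁ (bounds i)))) (proj₂ (bounds i)))
  g : Fin k → Fin w
  g i = fromℕ< (g-< i)
  g-inj : Injective _≡_ _≡_ g
  g-inj {i} {j} e = h-inj (∸-cancelʳ-≡ (proj₁ (bounds i)) (proj₁ (bounds j)) (Fin.fromℕ<-injective _ _ (g-< i) (g-< j) e))

-- Enumerates the 4n + 1 vertices of the fan, for comparison with the size of a side.
fan-vertex : ∀ n → Fin (suc (n * 4)) → Graph.V (F 4 n)
fan-vertex n zero    = nothing
fan-vertex n (suc i) = just (remQuot 4 i)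

fan-vertex-injective : ∀ n → Injective _≡_ _≡_ (fan-vertex n)
fan-vertex-injective n {zero} {zero} _ = refl
fan-vertex-injective n {suc i} {suc j} e = cong suc (≡-trans (≡-sym (Fin.combine-remQuot {n} 4 i))
  (≡-trans (cong (λ { (a , b) → combine a b }) (just-injective e)) (Fin.combine-remQuot {n} 4 j)))

-- Four neighbours of any vertex of the fan: for the centre, the first blade; for a vertex y of a
-- blade, the other three vertices of the blade and, in the place of y itself, the centre.
fan-neighbour : ∀ {n} → 0 < n → Graph.V (F 4 n) → Fin 4 → Graph.V (F 4 n)
fan-neighbour {suc n} _ nothing x = just (zero , x)
fan-neighbour {suc n} _ (just (a , y)) x with x Fin.≟ y
... | yes _ = nothing
... | no _  = just (a , x)

fan-neighbour-adj : ∀ {n} (h : 0 < n) p x → E (F 4 n) p (fan-neighbour h p x)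
fan-neighbour-adj {suc n} _ nothing x = _
fan-neighbour-adj {suc n} _ (just (a , y)) x with x Fin.≟ y
... | yes _   = _
... | no  x≢y = refl , x≢y ∘ ≡-sym

fan-neighbour-injective : ∀ {n} (h : 0 < n) p → Injective _≡_ _≡_ (fan-neighbour h p)
fan-neighbour-injective {suc n} h nothing e = cong proj₂ (just-injective e)
fan-neighbour-injective {suc n} h (just (a , y)) {x} {x′} e with x Fin.≟ y | x′ Fin.≟ y
... | yes p | yes q = ≡-trans p (≡-sym q)
... | no _  | no _  = cong proj₂ (just-injective e)

module Cut (H : Graph) (side : Graph.V H → Bool) where

  cut : Colouring H
  cut = record { col = λ u v → side u xor side v ; sym = λ u v → Bool.xor-comm (side u) (side v) }

  no-red-triangle : ¬ MonoCopy H cut true (K 3)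
  no-red-triangle (f , _ , h) = odd-cycle (side (f zero)) (side (f (suc zero))) (side (f (suc (suc zero))))
    (proj₂ (h zero (suc zero) λ ())) (proj₂ (h (suc zero) (suc (suc zero)) λ ()))
    (proj₂ (h zero (suc (suc zero)) λ ()))
    where
    odd-cycle : ∀ a b c → a xor b ≡ true → b xor c ≡ true → a xor c ≡ true → ⊥
    odd-cycle true  false true  _ _ ()
    odd-cycle false true  false _ _ ()
    odd-cycle true  false false _ () _
    odd-cycle false true  true  _ () _

  xor-false : ∀ a b → a xor b ≡ false → b ≡ a
  xor-false true  true  _ = refl
  xor-false false false _ = refl

  -- Every other vertex is joined to the centre by a blue edge, and blue edges do not cross the cut.
  one-sided : ∀ {n} (f : MonoCopy H cut false (F 4 n)) v → side (proj₁ f v) ≡ side (proj₁ f nothing)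
  one-sided _ nothing = refl
  one-sided (f , _ , h) (just x) = xor-false _ _ (proj₂ (h nothing (just x) _))

fan-too-large : ∀ {n lo} (h : Fin (suc (n * 4)) → ℕ) → Injective _≡_ _≡_ h →
                (∀ i → lo ≤ h i × h i < lo + n * 4) → ⊥
fan-too-large {n} {lo} h h-inj b = 1+n≰n (interval-size lo h h-inj b)

-- If s ≤ 8n, cutting after the first 4n vertices leaves at most 4n on each side, while a blue fan
-- has 4n + 1 vertices on one side.
ramsey-lower : ∀ n s → Arrows (K s) (K 3) (F 4 n) → 8 * n + 1 ≤ s
ramsey-lower n s arrows with 8 * n + 1 ≤? s
... | yes h = h
... | no ¬h = ⊥-elim ([ no-red-triangle , no-blue-fan ]′ (arrows cut))
  where
  side : Fin s → Bool
  side i = does (toℕ i <? n * 4)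
  open Cut (K s) side
  s≤8n : s ≤ n * 4 + n * 4
  s≤8n = ≤-pred (≤-trans (≰⇒> ¬h) (≤-reflexive (eq n)))
    where
    eq : ∀ n → 8 * n + 1 ≡ suc (n * 4 + n * 4)
    eq = solve-∀
  no-blue-fan : ¬ MonoCopy (K s) cut false (F 4 n)
  no-blue-fan copy@(f , f-inj , _) with side (f nothing) in e
  ... | true  = fan-too-large {n} {0} (toℕ ∘ f ∘ fan-vertex n)
    (fan-vertex-injective n ∘ f-inj ∘ Fin.toℕ-injective)
    (λ i → z≤n , does-true (_ <? _) (≡-trans (one-sided copy (fan-vertex n i)) e))
  ... | false = fan-too-large {n} {n * 4} (toℕ ∘ f ∘ fan-vertex n)
    (fan-vertex-injective n ∘ f-inj ∘ Fin.toℕ-injective)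
    (λ i → ≮⇒≥ (does-false (_ <? _) (≡-trans (one-sided copy (fan-vertex n i)) e)) ,
           ≤-trans (Fin.toℕ<n _) s≤8n)

initial : ∀ m → ℕ → Subset m
initial m       zero    = Subset.⊥
initial zero    (suc k) = Vec.[]
initial (suc m) (suc k) = inside Vec.∷ initial m k

∣initial∣ : ∀ {m k} → k ≤ m → ∣ initial m k ∣ ≡ k
∣initial∣ {m} z≤n = ∣⊥∣≡0 m
∣initial∣ (s≤s h) = cong suc (∣initial∣ h)

∈-initial : ∀ {m} k {i : Fin m} → i ∈ initial m k → toℕ i < k
∈-initial zero h = ⊥-elim (∉⊥ h)
∈-initial (suc k) {zero} h = s≤s z≤n
∈-initial (suc k) {suc i} h = s≤s (∈-initial k (drop-there h))

-- The new vertex is put on the side of the last 4n vertices, at most three of which it is joined to.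
star-lower : ∀ {n m} → 0 < n → m ≡ 8 * n → ∀ k →
             (∀ (S : Subset m) → ∣ S ∣ ≡ k → Arrows (KStar m S) (K 3) (F 4 n)) → 4 * n + 4 ≤ k
star-lower {n} {m} 0<n m≡8n k arrows with 4 * n + 4 ≤? k
... | yes h = h
... | no ¬h = ⊥-elim ([ no-red-triangle , no-blue-fan ]′ (arrows S (∣initial∣ k≤m) cut))
  where
  k≤4n+3 : k ≤ n * 4 + 3
  k≤4n+3 = ≤-pred (≤-trans (≰⇒> ¬h) (≤-reflexive (eq n)))
    where
    eq : ∀ n → 4 * n + 4 ≡ suc (n * 4 + 3)
    eq = solve-∀
  m≡4n+4n : m ≡ n * 4 + n * 4
  m≡4n+4n = ≡-trans m≡8n (eq n)
    where
    eq : ∀ n → 8 * n ≡ n * 4 + n * 4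
    eq = solve-∀
  -- Since 4n + 3 ≤ 8n, a set of k old vertices exists.
  k≤m : k ≤ m
  k≤m = ≤-trans k≤4n+3 (≤-trans (+-monoʳ-≤ (n * 4) (≤-trans (n≤1+n 3) (*-monoˡ-≤ 4 0<n))) (≤-reflexive (≡-sym m≡4n+4n)))
  S : Subset m
  S = initial m k
  side : Fin (suc m) → Bool
  side zero    = false
  side (suc i) = does (toℕ i <? n * 4)
  open Cut (KStar m S) side

  -- Positions are shifted by one, because `zero` is the new vertex.
  low : ∀ u → side u ≡ true → 1 ≤ toℕ u × toℕ u < 1 + n * 4
  low (suc i) e = s≤s z≤n , s≤s (does-true (_ <? _) e)

  high : ∀ u → u ≢ zero → side u ≡ false → suc (n * 4) ≤ toℕ u × toℕ u < suc (n * 4) + n * 4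
  high zero u≢0 _ = ⊥-elim (u≢0 refl)
  high (suc i) _ e = s≤s (≮⇒≥ (does-false (_ <? _) e)) , s≤s (≤-trans (Fin.toℕ<n i) (≤-reflexive m≡4n+4n))

  joined-high : ∀ u → StarE m S zero u → side u ≡ false → suc (n * 4) ≤ toℕ u × toℕ u < suc (n * 4) + 3
  joined-high (suc i) i∈S e = s≤s (≮⇒≥ (does-false (_ <? _) e)) , s≤s (≤-trans (∈-initial k i∈S) k≤4n+3)

  no-blue-fan : ¬ MonoCopy (KStar m S) cut false (F 4 n)
  no-blue-fan copy@(f , f-inj , edges) with side (f nothing) in e
  ... | true  = fan-too-large {n} {1} (toℕ ∘ f ∘ fan-vertex n)
    (fan-vertex-injective n ∘ f-inj ∘ Fin.toℕ-injective)
    (λ i → low _ (≡-trans (one-sided copy (fan-vertex n i)) e))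
  ... | false with Fin.any? (λ i → f (fan-vertex n i) Fin.≟ zero)
  ... | no ¬0 = fan-too-large {n} {suc (n * 4)} (toℕ ∘ f ∘ fan-vertex n)
    (fan-vertex-injective n ∘ f-inj ∘ Fin.toℕ-injective)
    (λ i → high _ (λ z → ¬0 (i , z)) (≡-trans (one-sided copy (fan-vertex n i)) e))
  -- If the new vertex is in the fan, its four fan neighbours lie on its own side, among the at most
  -- three vertices there to which it is joined.
  ... | yes (i , z) = 1+n≰n (interval-size {4} {3} (suc (n * 4)) (toℕ ∘ f ∘ next)
    (fan-neighbour-injective 0<n p ∘ f-inj ∘ Fin.toℕ-injective)
    (λ x → joined-high _ (subst (λ u → StarE m S u (f (next x))) z (proj₁ (edges p (next x) (fan-neighbour-adj 0<n p x))))
      (≡-trans (one-sided copy (next x)) e)))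
    where
    p = fan-vertex n i
    next = fan-neighbour 0<n p

-- Both bounds together.

-- The host with a partially joined vertex is a subgraph of the complete graph on the same vertices.
forget-star : ∀ {m b G} {S : Subset m} (c : Colouring (K (suc m))) →
  MonoCopy (KStar m S) (record { col = col c ; sym = Colouring.sym c }) b G → MonoCopy (K (suc m)) c b G
forget-star c (f , f-inj , h) = f , f-inj , λ u w e → (λ fu≡fw → StarE-irr (subst (StarE _ _ (f u)) (≡-sym fu≡fw) (proj₁ (h u w e)))) , proj₂ (h u w e)

theorem1p5 : ∀ (n : ℕ) → 4 ≤ n →
    IsRamsey (K 3) (F 4 n) (8 * n + 1) × IsStarCritical (K 3) (F 4 n) (8 * n + 1) (4 * n + 4)
theorem1p5 n 4≤n =
  (subst (λ r → Arrows (K r) (K 3) (F 4 n)) (+-comm 1 (8 * n)) complete , ramsey-lower n) ,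
  ((λ S ∣S∣ c → Upper.arrows 4≤n (m+n∸n≡m (8 * n) 1) S ∣S∣ c) ,
   star-lower (≤-trans (s≤s z≤n) 4≤n) (m+n∸n≡m (8 * n) 1))
  where
  -- The upper bound for the Ramsey number follows from the star-critical one: a colouring of the
  -- complete graph is restricted to a host in which one vertex keeps only 4n + 4 ≤ 8n edges.
  S : Subset (8 * n)
  S = initial (8 * n) (4 * n + 4)
  ∣S∣ : ∣ S ∣ ≡ 4 * n + 4
  ∣S∣ = ∣initial∣ (≤-trans (+-monoʳ-≤ (4 * n) (≤-trans 4≤n (m≤n*m n 4))) (≤-reflexive (eq n)))
    where
    eq : ∀ n → 4 * n + 4 * n ≡ 8 * n
    eq = solve-∀
  complete : Arrows (K (suc (8 * n))) (K 3) (F 4 n)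
  complete c = Sum.map (forget-star c) (forget-star c)
    (Upper.arrows 4≤n refl S ∣S∣ (record { col = col c ; sym = Colouring.sym c }))
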